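{- Let $m\ge 3$ be an integer, let $D\subset\{0,1,\dots,m-1\}$ with $1<\#D<m$, and let $K_{m,D}$ be the associated missing-digit set. Let $f\in\mathbb{Z}[x]$ be a nonconstant polynomial of degree $d\ge 1$ such that $f(k)>0$ for all integers $k\ge 1$, and let $a_n=\prod_{k=1}^n f(k)$ for $n\in\mathbb{N}$. Then the intersection $\left\{\frac{1}{a_n}:n\in\mathbb{N}\right\}\cap K_{m,D}$ is finite.
   Context: $\mathbb{N}=\{1,2,3,\dots\}$. The missing-digit set is $K_{m,D}:=\left\{\sum_{j=1}^\infty \frac{b_j}{m^j}: b_j\in D\text{ for all }j\ge 1\right\}\subset[0,1]$. -}

module Defs where

open import Data.Fin.Base using (Fin; toℕ)
open import Data.Fin.Properties using (nonZeroIndex)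
open import Data.Fin.Subset using (Subset) renaming (_∈_ to _∈ᶠ_)
open import Data.Integer.Base as ℤ using (ℤ; +_; 0ℤ; 1ℤ)
import Data.Integer.Properties as ℤ
open import Data.List.Base using (List)
open import Data.List.Membership.Propositional using () renaming (_∈_ to _∈ˡ_)
open import Data.Nat.Base as ℕ using (ℕ; zero; suc)
import Data.Nat.Properties as ℕ
open import Data.Product.Base using (∃; ∃-syntax; _×_)
open import Data.Rational.Base using (ℚ; 0ℚ; _/_; _+_; _-_; _<_; ∣_∣; 1/_)
open import Data.Rational.Literals using (fromℤ)
open import Data.Vec.Base using (Vec; []; _∷_)
open import Level using (0ℓ)
open import Relation.Binary.PropositionalEquality.Core using (_≡_)
open import Relation.Unary using (Pred; _≐_)

-- The first N terms of a series indexed from 1; u 0 is never used.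
partialSum : (ℕ → ℚ) → ℕ → ℚ
partialSum u zero    = 0ℚ
partialSum u (suc N) = partialSum u N + u (suc N)

-- ∑_{j ≥ 1} u j = x.
HasSum : (ℕ → ℚ) → ℚ → Set
HasSum u x = ∀ ε → 0ℚ < ε →
  ∃[ N₀ ] (∀ N → N₀ ℕ.≤ N → ∣ partialSum u N - x ∣ < ε)

digitTerm : ∀ {m} → (ℕ → Fin m) → ℕ → ℚ
digitTerm {m} b j = ((+ toℕ (b j)) / (m ℕ.^ j)) {{m^j≢0}}
  where
  m^j≢0 : ℕ.NonZero (m ℕ.^ j)
  m^j≢0 = ℕ.m^n≢0 m j {{nonZeroIndex (b j)}}

-- The rational points of the missing-digit set K_{m,D} ⊂ [0,1].
-- The digits are b 1, b 2, …; the value b 0 is irrelevant.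
K : (m : ℕ) → Subset m → Pred ℚ 0ℓ
K m D x = ∃[ b ] (∀ j → 1 ℕ.≤ j → b j ∈ᶠ D) × HasSum (digitTerm b) x

-- Coefficient vectors are in ascending order: c₀ ∷ c₁ ∷ … ∷ c_d ∷ [].
eval : ∀ {n} → Vec ℤ n → ℤ → ℤ
eval []       x = 0ℤ
eval (c ∷ cs) x = c ℤ.+ x ℤ.* eval cs x

PositiveOnℕ : ∀ {n} → Vec ℤ n → Set
PositiveOnℕ f = ∀ (k : ℤ) → 1ℤ ℤ.≤ k → 0ℤ ℤ.< eval f k

-- ∏_{k=1}^{n} f(k).
valueProduct : ∀ {l} → Vec ℤ l → ℕ → ℤ
valueProduct f zero    = 1ℤ
valueProduct f (suc n) = valueProduct f n ℤ.* eval f (+ suc n)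

valueProduct≢0 : ∀ {l} (f : Vec ℤ l) → PositiveOnℕ f →
                 ∀ n → ℤ.NonZero (valueProduct f n)
valueProduct≢0 f f>0 zero    = _
valueProduct≢0 f f>0 (suc n) =
  ℤ.i*j≢0 (valueProduct f n) (eval f (+ suc n))
    {{valueProduct≢0 f f>0 n}}
    {{ℤ.>-nonZero (f>0 (+ suc n) (ℤ.+≤+ (ℕ.s≤s ℕ.z≤n)))}}

-- { 1/aₙ : n ≥ 1 } with aₙ = ∏_{k=1}^{n} f(k).
Reciprocals : ∀ {l} (f : Vec ℤ l) → PositiveOnℕ f → Pred ℚ 0ℓ
Reciprocals f f>0 x =
  ∃[ n ] 1 ℕ.≤ n × x ≡ (1/ fromℤ (valueProduct f n)) {{valueProduct≢0 f f>0 n}}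

-- The elements can be listed exactly; this is stronger, constructively,
-- than being contained in a finite list.
Finite : Pred ℚ 0ℓ → Set
Finite P = ∃ λ (xs : List ℚ) → P ≐ (_∈ˡ xs)

{-# OPTIONS --safe #-}
-- A point 1/a belongs to K_{m,D} iff the long division of 1 by a in base m can be
-- carried out with digits in D, its remainders being congruent to m^N modulo a.
-- So it suffices to find, for a missing digit c, a power of m whose residue v
-- modulo a satisfies c/m < v/a < (c+1)/m.
--
-- Fix a prime p ∤ m dividing some value f(k); by periodicity p^e ∥ aₙ with e at least linear
-- in n.  Write aₙ = p^e w.  Pigeonhole applied to each factor f(k) gives an exponent
-- T with w ∣ m^L (m^T − 1) whose p-part is p^h, where p^h need only exceed all f(k).
-- Hence v_p(m^T − 1) = h + O(1) stays well below e.  Raising to powers of p makes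
-- this valuation exactly e − r, and then the powers m^(L + T i) run through a full
-- residue class modulo aₙ / p^r.  As soon as p^r > m, such a class meets the interval
-- above.
module Submission where

open import Defs

-- Powers modulo an integer and truncated binomial expansions.

module Arithmetic where

  open import Data.Nat.Base hiding (_/_)
  open import Data.Nat.Properties
  open import Data.Nat.Divisibility
  open import Data.Nat.DivMod
  open import Data.Nat.Primality
  open import Data.Nat.Induction using (<-wellFounded)
  open import Induction.WellFounded using (Acc; acc)
  open import Data.Nat.Tactic.RingSolver using (solve-∀)
  open import Data.Fin.Base as Fin using (Fin; toℕ; fromℕ<)
  import Data.Fin.Properties as Fin
  open import Data.Product.Base
  open import Data.Sum.Base using (inj₁; inj₂; [_,_]′)
  open import Relation.Nullary
  open import Relation.Binary.PropositionalEquality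

  %-≡⇒∣∸ : ∀ {x y} q .{{_ : NonZero q}} → x % q ≡ y % q → q ∣ y ∸ x
  %-≡⇒∣∸ {x} {y} q eq = divides (y / q ∸ x / q) (begin
    y ∸ x                                    ≡⟨ cong₂ _∸_ (m≡m%n+[m/n]*n y q) (m≡m%n+[m/n]*n x q) ⟩
    (y % q + y / q * q) ∸ (x % q + x / q * q) ≡⟨ cong (λ t → (y % q + y / q * q) ∸ (t + x / q * q)) eq ⟩
    (y % q + y / q * q) ∸ (y % q + x / q * q) ≡⟨ [m+n]∸[m+o]≡n∸o (y % q) _ _ ⟩
    y / q * q ∸ x / q * q                    ≡⟨ *-distribʳ-∸ q (y / q) (x / q) ⟨
    (y / q ∸ x / q) * q                      ∎)
    where open ≡-Reasoning

  m^n≡1+o : ∀ m .{{_ : NonZero m}} n → ∃[ z ] m ^ n ≡ 1 + z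
  m^n≡1+o m n = pred (m ^ n) , sym (suc-pred (m ^ n) {{m^n≢0 m n}})

  -- Two of the q + 1 powers b^0, ..., b^q agree modulo q; here `z` stands for b^(1 + t) - 1. The
  -- factor b^i absorbs whatever `q` has in common with `b`. The bound on the period later limits
  -- its p-part.
  power-repeats : ∀ b .{{_ : NonZero b}} q .{{_ : NonZero q}} →
    ∃[ i ] ∃[ t ] ∃[ z ] suc t ≤ q × b ^ suc t ≡ 1 + z × q ∣ b ^ i * z
  power-repeats b q
    with i , j , i<j , eq ← Fin.pigeonhole (n<1+n q) (λ (k : Fin (suc q)) → fromℕ< (m%n<n (b ^ toℕ k) q))
    with t , 1+i+t≡j ← m≤n⇒∃[o]m+o≡n i<j
    with z , b^t≡ ← m^n≡1+o b (suc t)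
    = toℕ i , t , z
    , ≤-trans (m≤n+m (suc t) (toℕ i)) (subst (_≤ q) (sym i+[1+t]≡j) (Fin.toℕ≤pred[n] j))
    , b^t≡
    , subst (q ∣_) eq₂ (%-≡⇒∣∸ q (Fin.fromℕ<-injective _ _ _ _ eq))
    where
    open ≡-Reasoning
    i+[1+t]≡j : toℕ i + suc t ≡ toℕ j
    i+[1+t]≡j = trans (+-suc (toℕ i) t) 1+i+t≡j
    eq₂ : b ^ toℕ j ∸ b ^ toℕ i ≡ b ^ toℕ i * z
    eq₂ = begin
      b ^ toℕ j ∸ b ^ toℕ i                   ≡⟨ cong (λ k → b ^ k ∸ b ^ toℕ i) i+[1+t]≡j ⟨
      b ^ (toℕ i + suc t) ∸ b ^ toℕ i          ≡⟨ cong (_∸ b ^ toℕ i) (^-distribˡ-+-* b (toℕ i) (suc t)) ⟩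
      b ^ toℕ i * b ^ suc t ∸ b ^ toℕ i        ≡⟨ cong (λ k → b ^ toℕ i * k ∸ b ^ toℕ i) b^t≡ ⟩
      b ^ toℕ i * suc z ∸ b ^ toℕ i            ≡⟨ cong (_∸ b ^ toℕ i) (*-suc (b ^ toℕ i) z) ⟩
      b ^ toℕ i + b ^ toℕ i * z ∸ b ^ toℕ i    ≡⟨ m+n∸m≡n (b ^ toℕ i) _ ⟩
      b ^ toℕ i * z                           ∎

  -- Binomial theorem cut after the linear term: `κ` gathers all higher terms, so that the error is
  -- visibly a multiple of z².
  [1+z]^k : ∀ z k → ∃[ κ ] (1 + z) ^ k ≡ 1 + k * z + z * z * κ
  [1+z]^k z zero    = 0 , cong suc (sym (*-zeroʳ (z * z)))
  [1+z]^k z (suc k) with κ , eq ← [1+z]^k z k =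
    k + κ + z * κ , trans (cong ((1 + z) *_) eq) (expand z k κ)
    where
    expand : ∀ z k κ → (1 + z) * (1 + k * z + z * z * κ) ≡
                       1 + (1 + k) * z + z * z * (k + κ + z * κ)
    expand = solve-∀

  [1+z]^k≡1+z*_ : ∀ z k → ∃[ c ] (1 + z) ^ k ≡ 1 + z * c
  [1+z]^k≡1+z*_ z k with κ , eq ← [1+z]^k z k =
    k + z * κ , trans eq (regroup z k κ)
    where
    regroup : ∀ z k κ → 1 + k * z + z * z * κ ≡ 1 + z * (k + z * κ)
    regroup = solve-∀

  -- Valuations at a prime and lifting the exponent.

  module _ {p : ℕ} (pr : Prime p) where

    private instance
      p≢0 : NonZero p
      p≢0 = prime⇒nonZero pr
      p>1 : NonTrivial p
      p>1 = prime⇒nonTrivial pr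

    ∤-* : ∀ {x y} → p ∤ x → p ∤ y → p ∤ x * y
    ∤-* {x} {y} p∤x p∤y p∣xy = [ p∤x , p∤y ]′ (euclidsLemma x y pr p∣xy)

    ∤1 : p ∤ 1
    ∤1 = >⇒∤ (nonTrivial⇒n>1 p)

    ∤-^ : ∀ {x} k → p ∤ x → p ∤ x ^ k
    ∤-^ zero    p∤x = ∤1
    ∤-^ (suc k) p∤x = ∤-* p∤x (∤-^ k p∤x)

    -- If p^(k + 1) x = c w, then Euclid's lemma puts the prime into `c`, since `w` is free of it;
    -- one factor p cancels and the recursion continues.
    ∣p^*⇒∣ : ∀ {w} k {x} → p ∤ w → w ∣ p ^ k * x → w ∣ x
    ∣p^*⇒∣         zero    {x} p∤w w∣ = subst (_ ∣_) (*-identityˡ x) w∣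
    ∣p^*⇒∣ {w} (suc k) {x} p∤w (divides c eq) with euclidsLemma c w pr (divides (p ^ k * x) (trans (sym eq) (comm p (p ^ k) x)))
      where
      comm : ∀ a b c → a * b * c ≡ b * c * a
      comm = solve-∀
    ... | inj₂ p∣w = contradiction p∣w p∤w
    ... | inj₁ (divides c′ c≡) = ∣p^*⇒∣ k p∤w (divides c′ (*-cancelˡ-≡ _ _ p (begin
      p * (p ^ k * x) ≡⟨ *-assoc p (p ^ k) x ⟨
      p * p ^ k * x   ≡⟨ eq ⟩
      c * w           ≡⟨ cong (_* w) c≡ ⟩
      c′ * p * w      ≡⟨ comm c′ p w ⟩
      p * (c′ * w)    ∎)))
      where
      open ≡-Reasoning
      comm : ∀ a b c → a * b * c ≡ b * (a * c)
      comm = solve-∀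

    p^*∣⇒∣ : ∀ k {w x} → p ∤ w → p ^ k ∣ w * x → p ^ k ∣ x
    p^*∣⇒∣ zero    {w} {x} _   _  = 1∣ x
    p^*∣⇒∣ (suc k) {w} {x} p∤w d with euclidsLemma w x pr (∣-trans (m∣m*n (p ^ k)) d)
    ... | inj₁ p∣w = contradiction p∣w p∤w
    ... | inj₂ (divides x′ refl) = subst (p * p ^ k ∣_) (*-comm p x′)
          (*-monoʳ-∣ p (p^*∣⇒∣ k p∤w (*-cancelˡ-∣ p (subst (p * p ^ k ∣_) (comm w x′ p) d))))
      where
      comm : ∀ a b c → a * (b * c) ≡ c * (a * b)
      comm = solve-∀

    p^-factor : ∀ x .{{_ : NonZero x}} → ∃[ e ] ∃[ q ] x ≡ p ^ e * q × p ∤ q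
    p^-factor x = go x (<-wellFounded x)
      where
      go : ∀ x .{{_ : NonZero x}} → Acc _<_ x → ∃[ e ] ∃[ q ] x ≡ p ^ e * q × p ∤ q
      go x (acc rs) with p ∣? x
      ... | no p∤x = 0 , x , sym (*-identityˡ x) , p∤x
      ... | yes p∣x@(divides y eq)
        with e , q , y≡ , p∤q ← go y {{quotient≢0 p∣x}} (rs (quotient-< p∣x)) =
        suc e , q , trans eq (trans (*-comm y p) (trans (cong (p *_) y≡) (sym (*-assoc p (p ^ e) q)))) , p∤q

    p^-≤ : ∀ {E e w} → p ∤ w → p ^ E ∣ p ^ e * w → E ≤ e
    p^-≤ {E} {e} {w} p∤w d with E ≤? e
    ... | yes E≤e = E≤e
    ... | no  E≰e = contradiction (*-cancelˡ-∣ (p ^ e) {{m^n≢0 p e}} p^e*p∣) p∤w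
      where
      p^e*p∣ : p ^ e * p ∣ p ^ e * w
      p^e*p∣ = subst (_∣ p ^ e * w) (*-comm p (p ^ e))
        (∣-trans (m≤n⇒m^∣ (≰⇒> E≰e)) d)
        where
        m≤n⇒m^∣ : ∀ {i j} → i ≤ j → p ^ i ∣ p ^ j
        m≤n⇒m^∣ {i} {j} i≤j = subst (p ^ i ∣_)
          (trans (sym (^-distribˡ-+-* p i (j ∸ i))) (cong (p ^_) (m+[n∸m]≡n i≤j))) (m∣m*n _)

    power≡1 : ∀ {b} → p ∤ b → ∀ k → ∃[ t ] ∃[ z ] b ^ suc t ≡ 1 + z × p ^ k ∣ z
    power≡1 {zero}  p∤b k = contradiction (p ∣0) p∤b
    power≡1 {b@(suc _)} p∤b k
      with i , t , z , _ , eq , d ← power-repeats b (p ^ k) {{m^n≢0 p k}} =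
      t , z , eq , p^*∣⇒∣ k (∤-^ i p∤b) d

    ∤-+ : ∀ {x} y → p ∤ x → p ∤ x + p * y
    ∤-+ {x} y p∤x d = p∤x (∣m+n∣m⇒∣n (subst (p ∣_) (+-comm x (p * y)) d) (m∣m*n y))

    -- The linear term of the expansion is p^(s + 1) A y with A y prime to p, and the remaining
    -- terms carry at least one more factor p; the valuation is unchanged.
    lift-coprime : ∀ {s y A} → p ∤ y → p ∤ A →
      ∃[ y′ ] (1 + p ^ suc s * y) ^ A ≡ 1 + p ^ suc s * y′ × p ∤ y′
    lift-coprime {s} {y} {A} p∤y p∤A with κ , eq ← [1+z]^k (p ^ suc s * y) A =
      A * y + p * (p ^ s * y * y * κ) ,
      trans eq (regroup p (p ^ s) y A κ) ,
      ∤-+ _ (∤-* p∤A p∤y)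
      where
      regroup : ∀ p P y A κ →
        1 + A * (p * P * y) + p * P * y * (p * P * y) * κ ≡
        1 + p * P * (A * y + p * (P * y * y * κ))
      regroup = solve-∀

    -- The exponent s + 2 ≥ 2 makes this hold for p = 2 as well.
    lift-p : ∀ {s y} → p ∤ y →
      ∃[ y′ ] (1 + p ^ (2 + s) * y) ^ p ≡ 1 + p ^ (3 + s) * y′ × p ∤ y′
    lift-p {s} {y} p∤y with κ , eq ← [1+z]^k (p ^ (2 + s) * y) p =
      y + p * (p ^ s * y * y * κ) ,
      trans eq (regroup p (p ^ s) y κ) ,
      ∤-+ _ p∤y
      where
      regroup : ∀ p P y κ →
        1 + p * (p * (p * P) * y) + p * (p * P) * y * (p * (p * P) * y) * κ ≡
        1 + p * (p * (p * P)) * (y + p * (P * y * y * κ))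
      regroup = solve-∀

    -- Iterates `lift-p`: each p-th power raises the valuation by exactly one.
    lift-p^ : ∀ {s y} g → p ∤ y →
      ∃[ y′ ] (1 + p ^ (2 + s) * y) ^ (p ^ g) ≡ 1 + p ^ (2 + (s + g)) * y′ × p ∤ y′
    lift-p^ {s} {y} zero    p∤y = y ,
      trans (^-identityʳ _) (cong (λ k → 1 + p ^ (2 + k) * y) (sym (+-identityʳ s))) , p∤y
    lift-p^ {s} {y} (suc g) p∤y
      with y₁ , eq₁ , p∤y₁ ← lift-p {s} p∤y
      with y₂ , eq₂ , p∤y₂ ← lift-p^ {suc s} g p∤y₁ =
      y₂ , (begin
        (1 + p ^ (2 + s) * y) ^ (p * p ^ g)   ≡⟨ ^-*-assoc (1 + p ^ (2 + s) * y) p (p ^ g) ⟨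
        ((1 + p ^ (2 + s) * y) ^ p) ^ (p ^ g) ≡⟨ cong (_^ (p ^ g)) eq₁ ⟩
        (1 + p ^ (3 + s) * y₁) ^ (p ^ g)      ≡⟨ eq₂ ⟩
        1 + p ^ (3 + (s + g)) * y₂            ≡⟨ cong (λ k → 1 + p ^ (2 + k) * y₂) (+-suc s g) ⟨
        1 + p ^ (2 + (s + suc g)) * y₂        ∎) , p∤y₂
      where open ≡-Reasoning

  -- The inequalities say c/m < v/a < (c+1)/m, so that c is the first base-m digit of
  -- v/a in each of its expansions.
  Hits : ℕ → ℕ → ℕ → Set
  Hits m a c = ∃[ N ] ∃[ v ] ∃[ X ] m ^ N ≡ v + a * X × c * a < m * v × m * v < suc c * a

  -- The orbit of powers of m modulo p^e w.

  module _ {p : ℕ} (pr : Prime p) (m : ℕ) where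

    private instance
      p≢0 : NonZero p
      p≢0 = prime⇒nonZero pr

    -- Encodes w ∣ m^L (m^T - 1) for an exponent T = A p^h whose p-part is exactly p^h. The factor
    -- m^L is there because `w` may share primes with `m`.
    Annihilated : ℕ → ℕ → Set
    Annihilated h w = ∃[ L ] ∃[ A ] ∃[ z ] p ∤ A × m ^ (A * p ^ h) ≡ 1 + z × w ∣ m ^ L * z

    annihilated-1 : .{{NonZero m}} → ∀ h → Annihilated h 1
    annihilated-1 h with z , eq ← m^n≡1+o m (1 * p ^ h) = 0 , 1 , z , ∤1 pr , eq , 1∣ _

    exponent≤ : ∀ {e t h} → p ^ e * t < p ^ h → p ∤ t → e ≤ h
    exponent≤ {e} {zero}      _ p∤t = contradiction (p ∣0) p∤t
    exponent≤ {e} {t@(suc _)} bd _  = ≮⇒≥ λ h<e →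
      <⇒≱ bd (≤-trans (^-monoʳ-≤ p (<⇒≤ h<e)) (m≤m*n (p ^ e) t))

    -- If z is divisible by w and by q, up to powers of m, then
    -- (1 + z)^q − 1 = z (q + z κ) is divisible by w q.
    annihilated-* : .{{NonZero m}} → ∀ {h w q} → .{{NonZero q}} → q < p ^ h → p ∤ q →
      Annihilated h w → Annihilated h (w * q)
    annihilated-* {h} {w} {q} q<p^h p∤q (L , A , z , p∤A , m^Ap^h≡ , w∣)
      with i , t , zₜ , 1+t≤q , m^t≡ , q∣ ← power-repeats m q
      with e , t′ , 1+t≡ , p∤t′ ← p^-factor pr (suc t)
      -- Since 1 + t ≤ q < p^h, the p-part p^e of the period satisfies e ≤ h. Thus 1 + t = p^e t′
      -- already divides A p^h t′, and no new factor p enters the exponent.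
      with f , e+f≡h ← m≤n⇒∃[o]m+o≡n (exponent≤ {e} {t′} {h} (subst (_< p ^ h) 1+t≡ (≤-<-trans 1+t≤q q<p^h)) p∤t′)
      with c₁ , eq₁ ← [1+z]^k≡1+z*_ z t′
      with c₂ , eq₂ ← [1+z]^k≡1+z*_ zₜ (p ^ f * A)
      with κ , eq₃ ← [1+z]^k (z * c₁) q
      = L + i , A * t′ * q , z * c₁ * (q + z * c₁ * κ)
      , ∤-* pr (∤-* pr p∤A p∤t′) p∤q
      , (begin
        m ^ (A * t′ * q * p ^ h)          ≡⟨ cong (m ^_) (comm₁ A t′ q (p ^ h)) ⟩
        m ^ (A * p ^ h * t′ * q)          ≡⟨ ^-*-assoc m (A * p ^ h * t′) q ⟨
        (m ^ (A * p ^ h * t′)) ^ q        ≡⟨ cong (_^ q) m^Ap^ht′≡ ⟩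
        (1 + z * c₁) ^ q                  ≡⟨ eq₃ ⟩
        1 + q * (z * c₁) + z * c₁ * (z * c₁) * κ ≡⟨ factor q (z * c₁) κ ⟩
        1 + z * c₁ * (q + z * c₁ * κ)     ∎)
      , subst (w * q ∣_) (trans (comm₂ (m ^ L) (m ^ i) (z * c₁) _) (cong (_* (z * c₁ * (q + z * c₁ * κ))) (sym (^-distribˡ-+-* m L i))))
          (*-pres-∣
            (subst (w ∣_) (*-assoc (m ^ L) z c₁) (∣m⇒∣m*n c₁ w∣))
            (subst (q ∣_) (sym (*-distribˡ-+ (m ^ i) q _))
              (∣m∣n⇒∣m+n (n∣m*n (m ^ i)) (subst (q ∣_) (*-assoc (m ^ i) (z * c₁) κ)
                (∣m⇒∣m*n κ (subst (λ x → q ∣ m ^ i * x) (sym zc₁≡) (subst (q ∣_) (*-assoc (m ^ i) zₜ c₂) (∣m⇒∣m*n c₂ q∣))))))))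
      where
      open ≡-Reasoning
      comm₁ : ∀ A t q P → A * t * q * P ≡ A * P * t * q
      comm₁ = solve-∀
      comm₂ : ∀ a b c d → a * c * (b * d) ≡ a * b * (c * d)
      comm₂ = solve-∀
      comm₃ : ∀ a b c d → a * (b * c) * d ≡ b * d * (c * a)
      comm₃ = solve-∀
      factor : ∀ q z κ → 1 + q * z + z * z * κ ≡ 1 + z * (q + z * κ)
      factor = solve-∀
      m^Ap^ht′≡ : m ^ (A * p ^ h * t′) ≡ 1 + z * c₁
      m^Ap^ht′≡ = trans (sym (^-*-assoc m (A * p ^ h) t′)) (trans (cong (_^ t′) m^Ap^h≡) eq₁)
      -- Both sides are m^(A p^h t′) - 1, with the exponent read once as a multiple of A p^h and
      -- once as a multiple of 1 + t. Hence q divides m^i z c₁.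
      zc₁≡ : z * c₁ ≡ zₜ * c₂
      zc₁≡ = suc-injective (begin
        1 + z * c₁                     ≡⟨ m^Ap^ht′≡ ⟨
        m ^ (A * p ^ h * t′)           ≡⟨ cong (λ k → m ^ (A * p ^ k * t′)) e+f≡h ⟨
        m ^ (A * p ^ (e + f) * t′)     ≡⟨ cong (λ k → m ^ (A * k * t′)) (^-distribˡ-+-* p e f) ⟩
        m ^ (A * (p ^ e * p ^ f) * t′) ≡⟨ cong (m ^_) (comm₃ A (p ^ e) (p ^ f) t′) ⟩
        m ^ (p ^ e * t′ * (p ^ f * A)) ≡⟨ cong (λ k → m ^ (k * (p ^ f * A))) 1+t≡ ⟨
        m ^ (suc t * (p ^ f * A))      ≡⟨ ^-*-assoc m (suc t) (p ^ f * A) ⟨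
        (m ^ suc t) ^ (p ^ f * A)      ≡⟨ cong (_^ (p ^ f * A)) m^t≡ ⟩
        (1 + zₜ) ^ (p ^ f * A)         ≡⟨ eq₂ ⟩
        1 + zₜ * c₂                    ∎)

    -- Modulo `a`, the expansion of m^L (1 + z)^i reduces to m^L + s u i, because m^L z² = s u z is
    -- a multiple of `a`. As `u` is invertible modulo p^r, the product u i takes every residue
    -- modulo p^r, so the whole class of ρ modulo `s` is reached.
    orbit-progression : ∀ {a s r L T z u ρ j} → a ≡ p ^ r * s →
      m ^ T ≡ 1 + z → m ^ L * z ≡ s * u → p ∤ u → a ∣ s * z →
      m ^ L ≡ ρ + s * j → ∀ k → ∃[ N ] ∃[ X ] m ^ N ≡ ρ + s * k + a * X
    orbit-progression {a} {s} {r} {L} {T} {z} {u} {ρ} {j} refl m^T≡ m^Lz≡ p∤u (divides c sz≡) m^L≡ k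
      -- Here `u ^ t` is an inverse of `u` modulo p^r, and d = p^r - 1 serves as -1. The exponent
      -- `i` below therefore solves u i ≡ k - j modulo p^r.
      with t , y , u^t≡ , divides x y≡ ← power≡1 pr p∤u r
      with d , 1+d≡p^r ← m≤n⇒∃[o]m+o≡n (m^n>0 p r) = go
      where
      open ≡-Reasoning
      i = u ^ t * (k + d * j)
      go : ∃[ N ] ∃[ X ] m ^ N ≡ ρ + s * k + p ^ r * s * X
      go with κ , eq ← [1+z]^k z i = L + T * i , j + x * (k + d * j) + c * u * κ , (begin
        m ^ (L + T * i)                  ≡⟨ ^-distribˡ-+-* m L (T * i) ⟩
        m ^ L * m ^ (T * i)              ≡⟨ cong (m ^ L *_) (^-*-assoc m T i) ⟨
        m ^ L * (m ^ T) ^ i              ≡⟨ cong (λ v → m ^ L * v ^ i) m^T≡ ⟩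
        m ^ L * (1 + z) ^ i              ≡⟨ cong (m ^ L *_) eq ⟩
        m ^ L * (1 + i * z + z * z * κ)  ≡⟨ expand₁ (m ^ L) i z κ ⟩
        m ^ L + (m ^ L * z) * i + (m ^ L * z) * z * κ  ≡⟨ cong₂ (λ v v′ → v + v′ * i + v′ * z * κ) m^L≡ m^Lz≡ ⟩
        ρ + s * j + s * u * i + s * u * z * κ ≡⟨ expand₂ ρ s j u i z κ ⟩
        ρ + s * j + s * (u * i) + (s * z) * u * κ ≡⟨ cong₂ (λ v v′ → ρ + s * j + s * v + v′ * u * κ) ui≡ sz≡ ⟩
        ρ + s * j + s * ((1 + x * p ^ r) * (k + d * j)) + (c * (p ^ r * s)) * u * κ
          ≡⟨ expand₃ ρ s j x (p ^ r) k d c u κ ⟩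
        ρ + s * k + s * ((1 + d) * j) + p ^ r * s * (x * (k + d * j) + c * u * κ)
          ≡⟨ cong (λ v → ρ + s * k + s * (v * j) + p ^ r * s * (x * (k + d * j) + c * u * κ)) 1+d≡p^r ⟩
        ρ + s * k + s * (p ^ r * j) + p ^ r * s * (x * (k + d * j) + c * u * κ)
          ≡⟨ expand₄ (ρ + s * k) s (p ^ r) j (x * (k + d * j)) (c * u * κ) ⟩
        ρ + s * k + p ^ r * s * (j + x * (k + d * j) + c * u * κ) ∎)
        where
        expand₁ : ∀ M i z κ → M * (1 + i * z + z * z * κ) ≡ M + (M * z) * i + (M * z) * z * κ
        expand₁ = solve-∀
        expand₂ : ∀ ρ s j u i z κ → ρ + s * j + s * u * i + s * u * z * κ ≡ ρ + s * j + s * (u * i) + (s * z) * u * κ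
        expand₂ = solve-∀
        expand₃ : ∀ ρ s j x P k d c u κ →
          ρ + s * j + s * ((1 + x * P) * (k + d * j)) + (c * (P * s)) * u * κ ≡
          ρ + s * k + s * ((1 + d) * j) + P * s * (x * (k + d * j) + c * u * κ)
        expand₃ = solve-∀
        expand₄ : ∀ y s P j b c → y + s * (P * j) + P * s * (b + c) ≡ y + P * s * (j + b + c)
        expand₄ = solve-∀
        ui≡ : u * i ≡ (1 + x * p ^ r) * (k + d * j)
        ui≡ = trans (sym (*-assoc u (u ^ t) _)) (cong (_* (k + d * j)) (trans u^t≡ (cong suc y≡)))

    -- The witness is the first term beyond `x`: index 0 when y > x, and otherwise one more than the
    -- quotient of x - y by `k`.
    progression-hits : ∀ x k .{{_ : NonZero k}} y → y ≤ x + k →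
      ∃[ i ] x < y + k * i × y + k * i ≤ x + k
    progression-hits x k y y≤x+k with x <? y
    ... | yes x<y = 0 , subst (x <_) y≡ x<y , subst (_≤ x + k) y≡ y≤x+k
      where
      y≡ : y ≡ y + k * 0
      y≡ = sym (trans (cong (y +_) (*-zeroʳ k)) (+-identityʳ y))
    ... | no x≮y with d , refl ← m≤n⇒∃[o]m+o≡n (≮⇒≥ x≮y) =
      suc (d / k) , above , below
      where
      open ≤-Reasoning
      above : y + d < y + k * suc (d / k)
      above = begin-strict
        y + d                     ≡⟨ cong (y +_) (m≡m%n+[m/n]*n d k) ⟩
        y + (d % k + d / k * k)   <⟨ +-monoʳ-< y (+-monoˡ-< _ (m%n<n d k)) ⟩
        y + (k + d / k * k)       ≡⟨ cong (y +_) (*-comm (suc (d / k)) k) ⟩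
        y + k * suc (d / k)       ∎
      below : y + k * suc (d / k) ≤ y + d + k
      below = begin
        y + k * suc (d / k)       ≡⟨ cong (y +_) (*-comm k (suc (d / k))) ⟩
        y + (k + d / k * k)       ≤⟨ +-monoʳ-≤ y (+-monoʳ-≤ k (m/n*n≤m d k)) ⟩
        y + (k + d)               ≡⟨ cong (y +_) (+-comm k d) ⟩
        y + (d + k)               ≡⟨ +-assoc y d k ⟨
        y + d + k                 ∎

    -- A suitable exponent T, a multiple of A p^h, has m^T - 1 of valuation exactly e - r, and w
    -- divides m^L (m^T - 1). The powers m^(L + T i) then fill a class modulo s = p^(e - r) w.
    -- Multiplied by `m`, this class has gaps m s < p^r s = a, too small to skip the interval
    -- between c a and (c + 1) a.
    orbit-hits : .{{NonZero m}} → p ∤ m → ∀ {r τ s₀ y h w e} → m < p ^ r →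
      m ^ suc τ ≡ 1 + p ^ (2 + s₀) * y → p ∤ y →
      .{{NonZero w}} → p ∤ w → Annihilated h w →
      r + (2 + (s₀ + h)) ≤ e → r + r ≤ e →
      ∀ c → Hits m (p ^ e * w) c
    orbit-hits p∤m {r} {τ} {s₀} {y} {h} {w} {e} m<p^r m^τ≡ p∤y p∤w
      (L , A , z₁ , p∤A , m^Ap^h≡ , w∣) e≥ 2r≤e c
      -- The surplus `g` is spent on further p-th powers: raising to p^(h + g) gives the valuation 2
      -- + s₀ + h + g, which is e - r.
      with g , e≡ ← m≤n⇒∃[o]m+o≡n e≥
      with y₁ , eq₁ , p∤y₁ ← lift-coprime pr {suc s₀} p∤y p∤A
      with y₂ , eq₂ , p∤y₂ ← lift-p^ pr {s₀} (h + g) p∤y₁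
      with b , eq₃ ← [1+z]^k≡1+z*_ z₁ (suc τ * p ^ g)
      -- `w` divides m^L z = p^e′ m^L y₂ and is prime to p, so it divides m^L y₂. The quotient `u`
      -- satisfies m^L z = s u and is prime to p.
      = hits (∣p^*⇒∣ pr e′ {m ^ L * y₂} p∤w (subst (w ∣_) w∣-eq (∣m⇒∣m*n b w∣)))
      where
      e′ = 2 + (s₀ + (h + g))
      s = p ^ e′ * w
      z = p ^ e′ * y₂
      T = suc τ * A * p ^ (h + g)
      r+e′≡e : r + e′ ≡ e
      r+e′≡e = trans (regroup r s₀ h g) e≡
        where
        regroup : ∀ r s h g → r + (2 + (s + (h + g))) ≡ r + (2 + (s + h)) + g
        regroup = solve-∀
      m^T≡ : m ^ T ≡ 1 + z
      m^T≡ = begin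
        m ^ T                                          ≡⟨ ^-*-assoc m (suc τ * A) (p ^ (h + g)) ⟨
        (m ^ (suc τ * A)) ^ p ^ (h + g)                ≡⟨ cong (_^ p ^ (h + g)) (^-*-assoc m (suc τ) A) ⟨
        ((m ^ suc τ) ^ A) ^ p ^ (h + g)                ≡⟨ cong (λ v → (v ^ A) ^ p ^ (h + g)) m^τ≡ ⟩
        ((1 + p ^ (2 + s₀) * y) ^ A) ^ p ^ (h + g)     ≡⟨ cong (_^ p ^ (h + g)) eq₁ ⟩
        (1 + p ^ (2 + s₀) * y₁) ^ p ^ (h + g)          ≡⟨ eq₂ ⟩
        1 + z                                          ∎
        where open ≡-Reasoning
      z≡ : z ≡ z₁ * b
      z≡ = suc-injective (begin
        1 + z                                ≡⟨ m^T≡ ⟨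
        m ^ (suc τ * A * p ^ (h + g))        ≡⟨ cong (λ v → m ^ (suc τ * A * v)) (^-distribˡ-+-* p h g) ⟩
        m ^ (suc τ * A * (p ^ h * p ^ g))    ≡⟨ cong (m ^_) (comm (suc τ) A (p ^ h) (p ^ g)) ⟩
        m ^ (A * p ^ h * (suc τ * p ^ g))    ≡⟨ ^-*-assoc m (A * p ^ h) (suc τ * p ^ g) ⟨
        (m ^ (A * p ^ h)) ^ (suc τ * p ^ g)  ≡⟨ cong (_^ (suc τ * p ^ g)) m^Ap^h≡ ⟩
        (1 + z₁) ^ (suc τ * p ^ g)           ≡⟨ eq₃ ⟩
        1 + z₁ * b                           ∎)
        where
        open ≡-Reasoning
        comm : ∀ t A P Q → t * A * (P * Q) ≡ A * P * (t * Q)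
        comm = solve-∀
      w∣-eq : m ^ L * z₁ * b ≡ p ^ e′ * (m ^ L * y₂)
      w∣-eq = trans (*-assoc (m ^ L) z₁ b) (trans (cong (m ^ L *_) (sym z≡)) (comm (m ^ L) (p ^ e′) y₂))
        where
        comm : ∀ a b c → a * (b * c) ≡ b * (a * c)
        comm = solve-∀
      a≡ : p ^ e * w ≡ p ^ r * s
      a≡ = trans (cong (λ v → p ^ v * w) (sym r+e′≡e)) (trans (cong (_* w) (^-distribˡ-+-* p r e′)) (*-assoc (p ^ r) (p ^ e′) w))
      -- The hypothesis 2 r ≤ e means r ≤ e′, so `z` contains the factor p^r that completes `s` to
      -- `a`.
      a∣sz : p ^ e * w ∣ s * z
      a∣sz with f , r+f≡e′ ← m≤n⇒∃[o]m+o≡n (+-cancelˡ-≤ r r e′ (subst (r + r ≤_) (sym r+e′≡e) 2r≤e)) =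
        divides (p ^ f * y₂) (begin
          s * (p ^ e′ * y₂)           ≡⟨ cong (λ v → s * (p ^ v * y₂)) r+f≡e′ ⟨
          s * (p ^ (r + f) * y₂)      ≡⟨ cong (λ v → s * (v * y₂)) (^-distribˡ-+-* p r f) ⟩
          s * (p ^ r * p ^ f * y₂)    ≡⟨ comm s (p ^ r) (p ^ f) y₂ ⟩
          p ^ f * y₂ * (p ^ r * s)    ≡⟨ cong (p ^ f * y₂ *_) a≡ ⟨
          p ^ f * y₂ * (p ^ e * w)    ∎)
        where
        open ≡-Reasoning
        comm : ∀ s R F y → s * (R * F * y) ≡ F * y * (R * s)
        comm = solve-∀
      instance
        s≢0 : NonZero s
        s≢0 = m*n≢0 (p ^ e′) w {{m^n≢0 p e′}}
        ms≢0 : NonZero (m * s)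
        ms≢0 = m*n≢0 m s
      m^Lz≡ : ∀ {u} → m ^ L * y₂ ≡ u * w → m ^ L * z ≡ s * u
      m^Lz≡ {u} u≡ = trans (comm₁ (m ^ L) (p ^ e′) y₂) (trans (cong (p ^ e′ *_) u≡) (comm₂ (p ^ e′) u w))
        where
        comm₁ : ∀ a b c → a * (b * c) ≡ b * (a * c)
        comm₁ = solve-∀
        comm₂ : ∀ a b c → a * (b * c) ≡ a * c * b
        comm₂ = solve-∀
      p∤u : ∀ {u} → m ^ L * y₂ ≡ u * w → p ∤ u
      p∤u u≡ p∣u = ∤-* pr (∤-^ pr L p∤m) p∤y₂ (subst (p ∣_) (sym u≡) (∣m⇒∣m*n w p∣u))
      hits : w ∣ m ^ L * y₂ → Hits m (p ^ e * w) c
      hits (divides u u≡)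
        -- The progression starts at m (m^L mod s), which is below m s and hence within the
        -- permitted overshoot whatever `c` is.
        with i , above , below ← progression-hits (c * (p ^ e * w)) (m * s) (m * (m ^ L % s))
               (≤-trans (*-monoʳ-≤ m (<⇒≤ (m%n<n (m ^ L) s))) (m≤n+m (m * s) _))
        with N , X , m^N≡ ← orbit-progression {r = r} {L = L} {T = T} a≡ m^T≡
               (m^Lz≡ {u} u≡) (p∤u {u} u≡) a∣sz (trans (m≡m%n+[m/n]*n (m ^ L) s) (cong (m ^ L % s +_) (*-comm (m ^ L / s) s))) i
        = N , m ^ L % s + s * i , X , m^N≡
        , subst (c * (p ^ e * w) <_) mv≡ above
        , subst (_< suc c * (p ^ e * w)) mv≡ (≤-<-trans below (begin-strict
            c * (p ^ e * w) + m * s     <⟨ +-monoʳ-< _ (*-monoˡ-< s m<p^r) ⟩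
            c * (p ^ e * w) + p ^ r * s ≡⟨ cong (c * (p ^ e * w) +_) a≡ ⟨
            c * (p ^ e * w) + p ^ e * w ≡⟨ +-comm _ (p ^ e * w) ⟩
            suc c * (p ^ e * w)         ∎))
        where
        open ≤-Reasoning
        mv≡ : m * (m ^ L % s) + m * s * i ≡ m * (m ^ L % s + s * i)
        mv≡ = trans (cong (m * (m ^ L % s) +_) (*-assoc m s i)) (sym (*-distribˡ-+ m _ _))

  -- Subexponential growth.

  n<2^n : ∀ n → n < 2 ^ n
  n<2^n zero    = s≤s z≤n
  n<2^n (suc n) = ≤-trans (+-mono-≤ (m^n>0 2 n) (n<2^n n))
    (≤-reflexive (cong (2 ^ n +_) (sym (+-identityʳ (2 ^ n)))))

  -- Uniformity in k ≤ q N, rather than k = N, lets the same exponent N bound all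
  -- factors G 1, …, G n with n ≤ q N, and makes the class closed under products.
  Subexponential : (ℕ → ℕ) → Set
  Subexponential G = ∀ q → ∃[ N₀ ] (∀ N → N₀ ≤ N → ∀ k → k ≤ q * N → G k < 2 ^ N)

  -- Two bounds by 2^M multiply to a bound by 2^N, while N ≤ 3 M turns the range k ≤ q N into k ≤ (3
  -- q) M. The successors in the threshold make `M` positive, which the rounding in N ≤ 3 M
  -- requires.
  halve : ∀ N₀ N → suc N₀ + suc N₀ ≤ N → ∃[ M ] N₀ ≤ M × N ≤ 3 * M × M + M ≤ N
  halve N₀ N N₀+N₀≤N = M , <⇒≤ N₀<M , N≤3M , M+M≤N
    where
    open ≤-Reasoning
    M = ⌊ N /2⌋
    N₀<M : suc N₀ ≤ M
    N₀<M = begin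
      suc N₀                   ≡⟨ n≡⌊n+n/2⌋ (suc N₀) ⟩
      ⌊ suc N₀ + suc N₀ /2⌋    ≤⟨ ⌊n/2⌋-mono N₀+N₀≤N ⟩
      M                        ∎
    M+M≤N : M + M ≤ N
    M+M≤N = begin
      M + M           ≤⟨ +-monoʳ-≤ M (⌊n/2⌋≤⌈n/2⌉ N) ⟩
      M + ⌈ N /2⌉     ≡⟨ ⌊n/2⌋+⌈n/2⌉≡n N ⟩
      N               ∎
    ⌈n/2⌉≤1+⌊n/2⌋ : ∀ n → ⌈ n /2⌉ ≤ suc ⌊ n /2⌋
    ⌈n/2⌉≤1+⌊n/2⌋ zero          = z≤n
    ⌈n/2⌉≤1+⌊n/2⌋ (suc zero)    = ≤-refl
    ⌈n/2⌉≤1+⌊n/2⌋ (suc (suc n)) = s≤s (⌈n/2⌉≤1+⌊n/2⌋ n)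
    N≤3M : N ≤ 3 * M
    N≤3M = begin
      N               ≡⟨ ⌊n/2⌋+⌈n/2⌉≡n N ⟨
      M + ⌈ N /2⌉     ≤⟨ +-monoʳ-≤ M (⌈n/2⌉≤1+⌊n/2⌋ N) ⟩
      M + (1 + M)     ≤⟨ +-monoʳ-≤ M (+-monoˡ-≤ M (≤-trans (s≤s z≤n) N₀<M)) ⟩
      M + (M + M)     ≡⟨ cong (λ v → M + (M + v)) (+-identityʳ M) ⟨
      3 * M           ∎

  2^M*2^M≤2^N : ∀ {M N} → M + M ≤ N → 2 ^ M * 2 ^ M ≤ 2 ^ N
  2^M*2^M≤2^N {M} {N} M+M≤N = subst (_≤ 2 ^ N) (^-distribˡ-+-* 2 M M) (^-monoʳ-≤ 2 M+M≤N)

  k≤3qM : ∀ q {k N M} → k ≤ q * N → N ≤ 3 * M → k ≤ (q * 3) * M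
  k≤3qM q {k} {N} {M} k≤ N≤ =
    ≤-trans k≤ (≤-trans (*-monoʳ-≤ q N≤) (≤-reflexive (sym (*-assoc q 3 M))))

  subexp-≤ : ∀ {G H} → (∀ k → G k ≤ H k) → Subexponential H → Subexponential G
  subexp-≤ G≤H sub q with N₀ , bound ← sub q =
    N₀ , λ N N₀≤N k k≤ → ≤-<-trans (G≤H k) (bound N N₀≤N k k≤)

  subexp-const : ∀ C → Subexponential (λ _ → C)
  subexp-const C q = C , λ N C≤N k _ → ≤-<-trans C≤N (n<2^n N)

  subexp-id : Subexponential (λ k → k)
  subexp-id q = suc (q * 3) + suc (q * 3) , bound
    where
    bound : ∀ N → suc (q * 3) + suc (q * 3) ≤ N → ∀ k → k ≤ q * N → k < 2 ^ N
    bound N N≥ k k≤ with M , 3q≤M , N≤3M , M+M≤N ← halve (q * 3) N N≥ = begin-strict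
      k               ≤⟨ k≤3qM q k≤ N≤3M ⟩
      (q * 3) * M     ≤⟨ *-monoˡ-≤ M 3q≤M ⟩
      M * M           <⟨ *-mono-< (n<2^n M) (n<2^n M) ⟩
      2 ^ M * 2 ^ M   ≤⟨ 2^M*2^M≤2^N {M} M+M≤N ⟩
      2 ^ N           ∎
      where open ≤-Reasoning

  subexp-* : ∀ {G H} → Subexponential G → Subexponential H → Subexponential (λ k → G k * H k)
  subexp-* {G} {H} subG subH q
    with N₁ , bound₁ ← subG (q * 3)
    with N₂ , bound₂ ← subH (q * 3) = suc (N₁ + N₂) + suc (N₁ + N₂) , bound
    where
    bound : ∀ N → suc (N₁ + N₂) + suc (N₁ + N₂) ≤ N → ∀ k → k ≤ q * N → G k * H k < 2 ^ N
    bound N N≥ k k≤ with M , N₁+N₂≤M , N≤3M , M+M≤N ← halve (N₁ + N₂) N N≥ = <-≤-trans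
      (*-mono-< (bound₁ M (m+n≤o⇒m≤o N₁ N₁+N₂≤M) k (k≤3qM q k≤ N≤3M))
                (bound₂ M (m+n≤o⇒n≤o N₁ N₁+N₂≤M) k (k≤3qM q k≤ N≤3M)))
      (2^M*2^M≤2^N {M} M+M≤N)

  subexp-+ : ∀ {G H} → Subexponential G → Subexponential H → Subexponential (λ k → G k + H k)
  subexp-+ {G} {H} subG subH q
    with N₁ , bound₁ ← subG (q * 3)
    with N₂ , bound₂ ← subH (q * 3) = suc (N₁ + N₂) + suc (N₁ + N₂) , bound
    where
    bound : ∀ N → suc (N₁ + N₂) + suc (N₁ + N₂) ≤ N → ∀ k → k ≤ q * N → G k + H k < 2 ^ N
    bound N N≥ k k≤ with M , N₁+N₂≤M , N≤3M , M+M≤N ← halve (N₁ + N₂) N N≥ = begin-strict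
      G k + H k       <⟨ +-mono-< (bound₁ M (m+n≤o⇒m≤o N₁ N₁+N₂≤M) k (k≤3qM q k≤ N≤3M))
                                 (bound₂ M (m+n≤o⇒n≤o N₁ N₁+N₂≤M) k (k≤3qM q k≤ N≤3M)) ⟩
      2 ^ M + 2 ^ M   ≡⟨ cong (2 ^ M +_) (+-identityʳ (2 ^ M)) ⟨
      2 ^ suc M       ≤⟨ ^-monoʳ-≤ 2 (1+M≤N M≥1 ) ⟩
      2 ^ N           ∎
      where
      open ≤-Reasoning
      1+M≤N : 1 ≤ M → suc M ≤ N
      1+M≤N 1≤M = ≤-trans (+-monoˡ-≤ M 1≤M) M+M≤N
      M≥1 : 1 ≤ M
      M≥1 = n≢0⇒n>0 λ { refl → contradiction (≤-trans N≥ N≤3M) λ () }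

  -- Products of consecutive values.

  module _ (F : ℕ → ℕ) where

    ∏ : ℕ → ℕ
    ∏ zero    = 1
    ∏ (suc n) = ∏ n * F (suc n)

    ∏-nonZero : (∀ k → NonZero (F (suc k))) → ∀ n → NonZero (∏ n)
    ∏-nonZero F≢0 zero    = _
    ∏-nonZero F≢0 (suc n) = m*n≢0 (∏ n) (F (suc n)) {{∏-nonZero F≢0 n}} {{F≢0 n}}

    ∏-∣ : ∀ n j → ∏ n ∣ ∏ (j + n)
    ∏-∣ n zero    = ∣-refl
    ∏-∣ n (suc j) = ∣m⇒∣m*n _ (∏-∣ n j)

    module _ {p} (pr : Prime p) where

      private instance
        p≢0 : NonZero p
        p≢0 = prime⇒nonZero pr

      -- The indices k₀ + p, k₀ + 2 p, ..., k₀ + E p contribute one factor p each, so the valuation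
      -- of the product grows at least linearly.
      p^∣∏ : ∀ {k₀} → (∀ j → p ∣ F (k₀ + p * j)) →
        ∀ E {n} → k₀ + p * E ≤ n → p ^ E ∣ ∏ n
      p^∣∏ {k₀} p∣F E {n} ≤n with j , refl ← m≤n⇒∃[o]m+o≡n ≤n =
        ∣-trans (p^∣∏′ E) (subst (λ x → ∏ (k₀ + p * E) ∣ ∏ x) (+-comm j _) (∏-∣ (k₀ + p * E) j))
        where
        step : ∀ k x E → k + suc x * suc E ≡ suc (x + (k + suc x * E))
        step = solve-∀
        p^∣∏′ : ∀ E → p ^ E ∣ ∏ (k₀ + p * E)
        p^∣∏′ zero    = 1∣ _
        p^∣∏′ (suc E) = subst (λ x → p ^ suc E ∣ ∏ x) (sym k₀+p*[1+E]≡)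
          (subst (_∣ ∏ (pred p + (k₀ + p * E)) * F (suc (pred p + (k₀ + p * E)))) (*-comm (p ^ E) p)
            (*-pres-∣ (∣-trans (p^∣∏′ E) (∏-∣ (k₀ + p * E) (pred p)))
              (subst (λ x → p ∣ F x) k₀+p*[1+E]≡ (p∣F (suc E)))))
          where
          k₀+p*[1+E]≡ : k₀ + p * suc E ≡ suc (pred p + (k₀ + p * E))
          k₀+p*[1+E]≡ = subst (λ x → k₀ + x * suc E ≡ suc (pred p + (k₀ + x * E))) (suc-pred p) (step k₀ (pred p) E)

      module _ (F≢0 : ∀ k → NonZero (F (suc k))) (m : ℕ) .{{_ : NonZero m}} where

        -- Induction on `n`: the p-part of each new value goes into p^e, and its cofactor, still
        -- below p^h, is absorbed by `annihilated-*`. That lemma leaves `h` unchanged, so one `h`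
        -- bounding single values serves the whole product.
        ∏-factor : ∀ h n → (∀ k → k ≤ n → F k < p ^ h) →
          ∃[ e ] ∃[ w ] ∏ n ≡ p ^ e * w × NonZero w × p ∤ w × Annihilated pr m h w
        ∏-factor h zero    _  = 0 , 1 , refl , _ , ∤1 pr , annihilated-1 pr m h
        ∏-factor h (suc n) F<
          with e , w , ∏≡ , w≢0 , p∤w , ann ← ∏-factor h n (λ k k≤n → F< k (m≤n⇒m≤1+n k≤n))
          with e′ , q , F≡ , p∤q ← p^-factor pr (F (suc n)) {{F≢0 n}}
          = e + e′ , w * q
          , trans (cong₂ _*_ ∏≡ F≡) (trans (comm (p ^ e) w (p ^ e′) q) (cong (_* (w * q)) (sym (^-distribˡ-+-* p e e′))))
          , m*n≢0 w q {{w≢0}} {{∤⇒≢0 p∤q}}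
          , ∤-* pr p∤w p∤q
          , annihilated-* pr m {h} {w} {q} {{∤⇒≢0 p∤q}} q<p^h p∤q ann
          where
          ∤⇒≢0 : ∀ {x} → p ∤ x → NonZero x
          ∤⇒≢0 p∤x = ≢-nonZero λ { refl → p∤x (p ∣0) }
          comm : ∀ a b c d → a * b * (c * d) ≡ a * c * (b * d)
          comm = solve-∀
          q<p^h : q < p ^ h
          q<p^h = ≤-<-trans (≤-trans (m≤n*m q (p ^ e′) {{m^n≢0 p e′}}) (≤-reflexive (sym F≡))) (F< (suc n) ≤-refl)

        -- Take h = N = 1 + ⌊n / 4p⌋. Slow growth gives F k < 2^N ≤ p^N for k ≤ n, whereas
        -- periodicity gives p^(2 N) ∣ ∏ n. The room between N and 2 N covers r + 2 + s₀; the choice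
        -- r = m is allowed because m < 2^m ≤ p^m.
        ∏-hits-from : ∀ {k₀ τ s₀ y N₀} → 1 < m → p ∤ m → (∀ j → p ∣ F (k₀ + p * j)) →
          (∀ N → N₀ ≤ N → ∀ k → k ≤ 4 * p * N → F k < 2 ^ N) →
          m ^ suc τ ≡ 1 + p ^ (2 + s₀) * y → p ∤ y →
          ∀ n → 4 * p * (N₀ + (k₀ + (m + (2 + s₀)))) ≤ n → ∀ c → Hits m (∏ n) c
        ∏-hits-from {k₀} {τ} {s₀} {y} {N₀} 1<m p∤m p∣F F<2^N m^τ≡ p∤y n n≥ c
          = hits (∏-factor N n F<p^N)
          where
          open ≤-Reasoning
          instance
            q≢0 : NonZero (4 * p)
            q≢0 = m*n≢0 4 p
          M = n / (4 * p)
          N = suc M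
          M₀ = N₀ + (k₀ + (m + (2 + s₀)))
          M₀≤M : M₀ ≤ M
          M₀≤M = subst (_≤ M) (m*n/n≡m M₀ (4 * p)) (/-monoˡ-≤ (4 * p) (subst (_≤ n) (*-comm (4 * p) M₀) n≥))
          n≤qN : n ≤ 4 * p * N
          n≤qN = begin
            n                                ≡⟨ m≡m%n+[m/n]*n n (4 * p) ⟩
            n % (4 * p) + M * (4 * p)        ≤⟨ +-monoˡ-≤ _ (m%n≤n n (4 * p)) ⟩
            N * (4 * p)                      ≡⟨ *-comm N (4 * p) ⟩
            4 * p * N                        ∎
          F<p^N : ∀ k → k ≤ n → F k < p ^ N
          F<p^N k k≤n = <-≤-trans
            (F<2^N N (m≤n⇒m≤1+n (m+n≤o⇒m≤o N₀ M₀≤M)) k (≤-trans k≤n n≤qN))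
            (^-monoˡ-≤ N (nonTrivial⇒n>1 p {{prime⇒nonTrivial pr}}))
          m<p^m : m < p ^ m
          m<p^m = <-≤-trans (n<2^n m) (^-monoˡ-≤ m (nonTrivial⇒n>1 p {{prime⇒nonTrivial pr}}))
          m+2+s₀≤N : m + (2 + s₀) ≤ N
          m+2+s₀≤N = m≤n⇒m≤1+n (m+n≤o⇒n≤o k₀ (m+n≤o⇒n≤o N₀ M₀≤M))
          m≤N : m ≤ N
          m≤N = m+n≤o⇒m≤o m m+2+s₀≤N
          m+2+s₀+N≤ : m + (2 + (s₀ + N)) ≤ N + N
          m+2+s₀+N≤ = subst (_≤ N + N) (+-assoc m (2 + s₀) N) (+-monoˡ-≤ N m+2+s₀≤N)
          k₀+2≤M : k₀ + 2 ≤ M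
          k₀+2≤M = begin
            k₀ + 2                ≤⟨ +-monoʳ-≤ k₀ (≤-trans (m≤m+n 2 s₀) (m≤n+m (2 + s₀) m)) ⟩
            k₀ + (m + (2 + s₀))   ≤⟨ m+n≤o⇒n≤o N₀ M₀≤M ⟩
            M                     ∎
          -- Dividing by 4 p instead of 2 p leaves space for `k₀` and for the rounding up in `N`.
          k₀+p*2N≤n : k₀ + p * (N + N) ≤ n
          k₀+p*2N≤n = begin
            k₀ + p * (N + N)           ≤⟨ +-monoˡ-≤ _ (m≤n*m k₀ p) ⟩
            p * k₀ + p * (N + N)       ≡⟨ regroup p k₀ M ⟩
            p * (k₀ + 2 + (M + M))     ≤⟨ *-monoʳ-≤ p (+-monoˡ-≤ (M + M) k₀+2≤M) ⟩
            p * (M + (M + M))          ≤⟨ *-monoʳ-≤ p (m≤n+m (M + (M + M)) M) ⟩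
            p * (M + (M + (M + M)))    ≡⟨ regroup′ p M ⟩
            M * (4 * p)                ≤⟨ m/n*n≤m n (4 * p) ⟩
            n                          ∎
            where
            regroup : ∀ p k M → p * k + p * (suc M + suc M) ≡ p * (k + 2 + (M + M))
            regroup = solve-∀
            regroup′ : ∀ p M → p * (M + (M + (M + M))) ≡ M * (4 * p)
            regroup′ = solve-∀
          2N≤e : ∀ {e w} → ∏ n ≡ p ^ e * w → p ∤ w → N + N ≤ e
          2N≤e {e} {w} ∏≡ p∤w = p^-≤ pr {N + N} {e} {w} p∤w
            (subst (p ^ (N + N) ∣_) ∏≡ (p^∣∏ {k₀} p∣F (N + N) k₀+p*2N≤n))
          hits : (∃[ e ] ∃[ w ] ∏ n ≡ p ^ e * w × NonZero w × p ∤ w × Annihilated pr m N w) → Hits m (∏ n) c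
          hits (e , w , ∏≡ , w≢0 , p∤w , ann) = subst (λ a → Hits m a c) (sym ∏≡)
            (orbit-hits pr m p∤m {m} {τ} {s₀} {y} {N} {w} {e} m<p^m m^τ≡ p∤y {{w≢0}} p∤w ann
              (≤-trans m+2+s₀+N≤ (2N≤e {e} {w} ∏≡ p∤w))
              (≤-trans (+-mono-≤ m≤N m≤N) (2N≤e {e} {w} ∏≡ p∤w)) c)

        m^1+t≢1 : 1 < m → ∀ t z → m ^ suc t ≡ 1 + z → NonZero z
        m^1+t≢1 1<m t (suc z) _  = _
        m^1+t≢1 1<m t zero    eq = contradiction (sym eq) (<⇒≢ (^-monoʳ-< m 1<m {0} {suc t} (s≤s z≤n)))

        ∏-hits : 1 < m → p ∤ m → ∀ {k₀} → (∀ j → p ∣ F (k₀ + p * j)) → Subexponential F →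
          ∃[ n₀ ] (∀ n → n₀ ≤ n → ∀ c → Hits m (∏ n) c)
        ∏-hits 1<m p∤m {k₀} p∣F sub
          -- The modulus is p² so that the valuation of m^(1 + τ) - 1 is at least 2, as `lift-p`
          -- demands; `s₀` is the excess over 2.
          with τ , z , m^τ≡ , p²∣z ← power≡1 pr p∤m 2
          with e₁ , y , z≡ , p∤y ← p^-factor pr z {{m^1+t≢1 1<m τ z m^τ≡}}
          with s₀ , refl ← m≤n⇒∃[o]m+o≡n (p^-≤ pr {2} {e₁} {y} p∤y (subst (p ^ 2 ∣_) z≡ p²∣z))
          with N₀ , F<2^N ← sub (4 * p) =
          _ , ∏-hits-from {k₀} {τ} {s₀} {y} {N₀} 1<m p∤m p∣F F<2^N (trans m^τ≡ (cong suc z≡)) p∤y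

-- Infinite paths in finite graphs and long division in base m.

module LongDivision where

  open Arithmetic using (Hits)
  open import Data.Nat.Base hiding (_/_)
  open import Data.Nat.Properties
  open import Data.Nat.Tactic.RingSolver using (solve-∀)
  open import Data.Nat.Induction using (<-wellFounded)
  open import Induction.WellFounded using (Acc; acc)
  open import Data.Fin.Base as Fin using (Fin; toℕ; fromℕ<)
  import Data.Fin.Properties as Fin
  open import Data.Fin.Subset using (Subset; ∣_∣; ⊤; _∈_; _∉_; _-_)
  open import Data.Fin.Subset.Properties
    using (_∈?_; ∈⊤; ∣⊤∣≡n; p⊆q⇒∣p∣≤∣q∣; x∈p⇒∣p-x∣<∣p∣; x∈p∧x≢y⇒x∈p-y)
  open import Data.Product.Base
  open import Relation.Nullary
  open import Relation.Nullary.Decidable using (map′; decidable-stable; ¬?; _×-dec_)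
  open import Relation.Unary using (Decidable)
  open import Relation.Binary.Definitions using (tri<; tri≈; tri>)
  open import Relation.Binary.PropositionalEquality

  ∃∉ : ∀ {n} (D : Subset n) → ∣ D ∣ < n → ∃[ c ] c ∉ D
  ∃∉ {n} D ∣D∣<n with Fin.any? (λ c → ¬? (c ∈? D))
  ... | yes c∉D = c∉D
  ... | no  ∄   = contradiction ∣D∣<n (≤⇒≯ (subst (_≤ ∣ D ∣) (∣⊤∣≡n n)
    (p⊆q⇒∣p∣≤∣q∣ {p = ⊤} λ {c} _ → decidable-stable (c ∈? D) λ c∉D → ∄ (c , c∉D))))

  InfinitePath : ∀ {A : Set} → (A → A → Set) → A → Set
  InfinitePath {A} E x = Σ[ σ ∈ (ℕ → A) ] σ 0 ≡ x × (∀ j → E (σ j) (σ (suc j)))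

  module _ {n} {E : Fin n → Fin n → Set} (E? : ∀ x y → Dec (E x y)) where

    -- Dead ends are discarded from the set S of candidates until each
    -- remaining vertex has a successor in S.
    infinitePath? : Decidable (InfinitePath E)
    infinitePath? = prune ⊤ (<-wellFounded _) λ x∉⊤ → contradiction ∈⊤ x∉⊤
      where
      Successor : Subset n → Fin n → Set
      Successor S x = ∃[ y ] y ∈ S × E x y

      follow : ∀ {S x} → x ∈ S → (∀ {x} → x ∈ S → Successor S x) → InfinitePath E x
      follow {S} {x} x∈S next = (λ j → proj₁ (path j)) , refl , λ j → proj₂ (proj₂ (next (proj₂ (path j))))
        where
        path : ℕ → ∃ (_∈ S)
        path zero    = x , x∈S
        path (suc j) with y , y∈S , _ ← next (proj₂ (path j)) = y , y∈S

      prune : ∀ S → Acc _<_ ∣ S ∣ → (∀ {x} → x ∉ S → ¬ InfinitePath E x) → Decidable (InfinitePath E)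
      prune S (acc rec) dead with Fin.any? (λ x → (x ∈? S) ×-dec ¬? (Fin.any? λ y → (y ∈? S) ×-dec E? x y))
      ... | yes (z , z∈S , stuck) = prune (S - z) (rec (x∈p⇒∣p-x∣<∣p∣ z∈S)) dead′
        where
        -- A path from `z` either moves to a vertex of `S`, against `stuck`, or its tail is an
        -- infinite path from a vertex already known to be dead.
        z-dead : ¬ InfinitePath E z
        z-dead (σ , refl , path) with σ 1 ∈? S
        ... | yes σ₁∈S = stuck (σ 1 , σ₁∈S , path 0)
        ... | no  σ₁∉S = dead σ₁∉S ((λ j → σ (suc j)) , refl , λ j → path (suc j))
        dead′ : ∀ {x} → x ∉ S - z → ¬ InfinitePath E x
        dead′ {x} x∉S-z with x Fin.≟ z | x ∈? S
        ... | yes refl | _       = z-dead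
        ... | no  x≢z  | yes x∈S = contradiction (x∈p∧x≢y⇒x∈p-y x∈S x≢z) x∉S-z
        ... | no  x≢z  | no  x∉S = dead x∉S
      ... | no ∄stuck = λ x → case x
        where
        next : ∀ {x} → x ∈ S → Successor S x
        next {x} x∈S = decidable-stable (Fin.any? λ y → (y ∈? S) ×-dec E? x y)
          λ stuck → ∄stuck (x , x∈S , stuck)
        case : Decidable (InfinitePath E)
        case x with x ∈? S
        ... | yes x∈S = yes (follow x∈S next)
        ... | no  x∉S = no (dead x∉S)

  -- `r` may be 0 or `a`, which are congruent modulo `a`; the strict bounds on `v` rule out this
  -- ambiguity, and unequal quotients separate the two sides.
  remainder-unique : ∀ {a P X r v} → a * P + r ≡ v + a * X → r ≤ a → 0 < v → v < a → r ≡ v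
  remainder-unique {a} {P} {X} {r} {v} eq r≤a 0<v v<a with <-cmp P X
  ... | tri< P<X _ _ = contradiction eq (<⇒≢ (begin-strict
    a * P + r     ≤⟨ +-monoʳ-≤ (a * P) r≤a ⟩
    a * P + a     ≡⟨ +-comm (a * P) a ⟩
    a + a * P     ≡⟨ *-suc a P ⟨
    a * suc P     ≤⟨ *-monoʳ-≤ a P<X ⟩
    a * X         <⟨ +-monoˡ-< (a * X) 0<v ⟩
    v + a * X     ∎))
    where open ≤-Reasoning
  ... | tri≈ _ refl _ = +-cancelˡ-≡ (a * P) r v (trans eq (+-comm v (a * P)))
  ... | tri> _ _ X<P = contradiction (sym eq) (<⇒≢ (begin-strict
    v + a * X     <⟨ +-monoˡ-< (a * X) v<a ⟩
    a + a * X     ≡⟨ *-suc a X ⟨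
    a * suc X     ≤⟨ *-monoʳ-≤ a X<P ⟩
    a * P         ≤⟨ m≤m+n (a * P) r ⟩
    a * P + r     ∎))
    where open ≤-Reasoning

  -- Digits are read from b 1 on; b 0 is ignored, as in K.
  prefix : ∀ {m} → (ℕ → Fin m) → ℕ → ℕ
  prefix     b zero    = 0
  prefix {m} b (suc N) = m * prefix b N + toℕ (b (suc N))

  module _ (m : ℕ) (D : Subset m) (a : ℕ) where

    Step : ℕ → ℕ → Set
    Step ρ ρ′ = ∃[ b ] b ∈ D × m * ρ ≡ a * toℕ b + ρ′

    -- A remainder equal to a is allowed: it produces the expansions ending in
    -- m − 1, m − 1, ….
    Division : Set
    Division = Σ[ ρ ∈ (ℕ → ℕ) ] ρ 0 ≡ 1 × (∀ j → ρ j ≤ a) × (∀ j → Step (ρ j) (ρ (suc j)))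

    step? : ∀ ρ ρ′ → Dec (Step ρ ρ′)
    step? ρ ρ′ = Fin.any? λ b → (b ∈? D) ×-dec (m * ρ ≟ a * toℕ b + ρ′)

    -- Remainders stay in {0, ..., a}, so a division is an infinite path from 1 in a finite graph.
    -- Its decidability is what allows the intersection to be listed exactly.
    division? : .{{NonZero a}} → Dec Division
    division? = map′ to from (infinitePath? (λ x y → step? (toℕ x) (toℕ y)) one)
      where
      E : Fin (suc a) → Fin (suc a) → Set
      E x y = Step (toℕ x) (toℕ y)
      one : Fin (suc a)
      one = fromℕ< (s≤s (>-nonZero⁻¹ a))
      to : InfinitePath E one → Division
      to (σ , σ₀≡ , path) = (λ j → toℕ (σ j)) , trans (cong toℕ σ₀≡) (Fin.toℕ-fromℕ< (s≤s (>-nonZero⁻¹ a)))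
        , (λ j → Fin.toℕ≤pred[n] (σ j)) , path
      from : Division → InfinitePath E one
      from (ρ , ρ₀≡ , ρ≤a , path) = (λ j → fromℕ< (s≤s (ρ≤a j)))
        , Fin.fromℕ<-cong _ _ ρ₀≡ (s≤s (ρ≤a 0)) (s≤s (>-nonZero⁻¹ a))
        , λ j → subst₂ Step (sym (Fin.toℕ-fromℕ< _)) (sym (Fin.toℕ-fromℕ< _)) (path j)

    module _ {ρ : ℕ → ℕ} (ρ₀≡1 : ρ 0 ≡ 1) (ρ≤a : ∀ j → ρ j ≤ a) (path : ∀ j → Step (ρ j) (ρ (suc j))) where

      -- The step out of `ρ j` emits digit number j + 1, whence the predecessor. The value at 0
      -- merely repeats the first digit.
      digit : ℕ → Fin m
      digit j = proj₁ (path (pred j))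

      power≡ : ∀ N → m ^ N ≡ a * prefix digit N + ρ N
      power≡ zero    = trans (sym ρ₀≡1) (cong (_+ ρ 0) (sym (*-zeroʳ a)))
      power≡ (suc N) with eq ← power≡ N | b , _ , step ← path N =
        trans (cong (m *_) eq) (trans (*-distribˡ-+ m (a * P) (ρ N))
          (trans (cong (m * (a * P) +_) step) (regroup m a P (toℕ b) (ρ (suc N)))))
        where
        P = prefix digit N
        regroup : ∀ m a P b ρ → m * (a * P) + (a * b + ρ) ≡ a * (m * P + b) + ρ
        regroup = solve-∀

      -- The remainder after N steps is congruent to m^N and hence equals `v`. The next digit `b`
      -- satisfies a b ≤ m v ≤ a (b + 1), and the strict inequalities for `c` leave only b = c.
      hits⇒∈D : ∀ (c : Fin m) → Hits m a (toℕ c) → c ∈ D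
      hits⇒∈D c (N , v , X , m^N≡ , ca<mv , mv<[1+c]a) = in-D
        where
        open ≤-Reasoning
        0<v : 0 < v
        0<v = n≢0⇒n>0 λ { refl → n≮0 (subst (toℕ c * a <_) (*-zeroʳ m) ca<mv) }
        v<a : v < a
        v<a = *-cancelˡ-< m v a (<-≤-trans mv<[1+c]a (*-monoˡ-≤ a (Fin.toℕ<n c)))
        ρ≡v : ρ N ≡ v
        ρ≡v = remainder-unique {a} {prefix digit N} {X} (trans (sym (power≡ N)) m^N≡) (ρ≤a N) 0<v v<a
        in-D : c ∈ D
        in-D with b , b∈D , step ← path N with <-cmp (toℕ b) (toℕ c)
        ... | tri≈ _ b≡c _ = subst (_∈ D) (Fin.toℕ-injective b≡c) b∈D
        ... | tri< b<c _ _ = contradiction ca<mv (≤⇒≯ (begin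
          m * v                      ≡⟨ cong (m *_) ρ≡v ⟨
          m * ρ N                    ≡⟨ step ⟩
          a * toℕ b + ρ (suc N)      ≤⟨ +-monoʳ-≤ (a * toℕ b) (ρ≤a (suc N)) ⟩
          a * toℕ b + a              ≡⟨ trans (+-comm (a * toℕ b) a) (sym (*-suc a (toℕ b))) ⟩
          a * suc (toℕ b)            ≤⟨ *-monoʳ-≤ a b<c ⟩
          a * toℕ c                  ≡⟨ *-comm a (toℕ c) ⟩
          toℕ c * a                  ∎))
        ... | tri> _ _ c<b = contradiction mv<[1+c]a (≤⇒≯ (begin
          suc (toℕ c) * a            ≡⟨ *-comm (suc (toℕ c)) a ⟩
          a * suc (toℕ c)            ≤⟨ *-monoʳ-≤ a c<b ⟩
          a * toℕ b                  ≤⟨ m≤m+n (a * toℕ b) (ρ (suc N)) ⟩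
          a * toℕ b + ρ (suc N)      ≡⟨ step ⟨
          m * ρ N                    ≡⟨ cong (m *_) ρ≡v ⟩
          m * v                      ∎))

-- Values of an integer polynomial: growth, periodicity and prime divisors.

module PolynomialValues where

  open Arithmetic using (Hits; Subexponential; subexp-const; subexp-id; subexp-≤; subexp-+; subexp-*; ∏; ∏-hits)
  open import Data.Nat.Base as ℕ hiding (_/_; _+_; _*_; _≤_; _<_; ∣_-_∣)
  import Data.Nat.Properties as ℕ
  import Data.Nat.Divisibility as ℕ
  open import Data.Nat.Primality
  open import Data.Nat.Primality.Factorisation using (factorise)
  open import Data.List.Base using (List; []; _∷_)
  open import Data.List.Relation.Unary.All using (_∷_)
  open import Data.Integer.Base as ℤ using (ℤ; +_; 0ℤ; 1ℤ; ∣_∣; _+_; _*_; _-_; -_; +≤+; +<+)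
  import Data.Integer.Properties as ℤ
  open import Data.Integer.Tactic.RingSolver using (solve-∀)
  open import Data.Vec.Base using (Vec; []; _∷_; last)
  open import Data.Product.Base
  open import Relation.Nullary
  open import Relation.Binary.PropositionalEquality

  ∃-prime-divisor : ∀ n → 1 ℕ.< n → ∃[ p ] Prime p × p ℕ.∣ n
  ∃-prime-divisor n@(suc _) 1<n with factorise n
  ... | record { factors = []      ; isFactorisation = n≡1 } = contradiction (sym n≡1) (ℕ.<⇒≢ 1<n)
  ... | record { factors = p ∷ ps ; isFactorisation = n≡ ; factorsPrime = pr ∷ _ } =
    p , pr , subst (p ℕ.∣_) (sym n≡) (ℕ.m∣m*n _)

  value : ∀ {n} → Vec ℤ n → ℕ → ℕ
  value f k = ∣ eval f (+ k) ∣

  -- The divisibility h ∣ f(x + h) - f(x), by recursion on the Horner form. It yields both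
  -- periodicity modulo p and Schur's argument.
  eval-+ : ∀ {n} (f : Vec ℤ n) x h → ∃[ c ] eval f (x + h) ≡ eval f x + h * c
  eval-+ []       x h = 0ℤ , sym (trans (ℤ.+-identityˡ (h * 0ℤ)) (ℤ.*-zeroʳ h))
  eval-+ (a ∷ f) x h with c , eq ← eval-+ f x h =
    eval f x + x * c + h * c , trans (cong (λ v → a + (x + h) * v) eq) (expand a x h (eval f x) c)
    where
    expand : ∀ a x h y c → a + (x + h) * (y + h * c) ≡ a + x * y + h * (y + x * c + h * c)
    expand = solve-∀

  eval-subexponential : ∀ {n} (f : Vec ℤ n) → Subexponential (value f)
  eval-subexponential []      = subexp-const 0
  eval-subexponential (a ∷ f) = subexp-≤ bound
    (subexp-+ (subexp-const ∣ a ∣) (subexp-* subexp-id (eval-subexponential f)))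
    where
    bound : ∀ k → value (a ∷ f) k ℕ.≤ ∣ a ∣ ℕ.+ k ℕ.* value f k
    bound k = subst (λ v → value (a ∷ f) k ℕ.≤ ∣ a ∣ ℕ.+ v) (ℤ.abs-* (+ k) (eval f (+ k)))
      (ℤ.∣i+j∣≤∣i∣+∣j∣ a (+ k * eval f (+ k)))

  -- Reverse triangle inequality for one Horner step: it turns nonvanishing of the inner value `y`
  -- into growth of a + x y.
  x≤∣a+xy∣+∣a∣ : ∀ a x y → 1 ℕ.≤ ∣ y ∣ → x ℕ.≤ ∣ a + + x * y ∣ ℕ.+ ∣ a ∣
  x≤∣a+xy∣+∣a∣ a x y 1≤∣y∣ = begin
    x                              ≤⟨ ℕ.m≤m*n x ∣ y ∣ {{ℕ.>-nonZero 1≤∣y∣}} ⟩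
    x ℕ.* ∣ y ∣                    ≡⟨ ℤ.abs-* (+ x) y ⟨
    ∣ + x * y ∣                    ≡⟨ cong ∣_∣ (cancel a (+ x * y)) ⟩
    ∣ a + + x * y - a ∣            ≤⟨ ℤ.∣i-j∣≤∣i∣+∣j∣ (a + + x * y) a ⟩
    ∣ a + + x * y ∣ ℕ.+ ∣ a ∣      ∎
    where
    open ℕ.≤-Reasoning
    cancel : ∀ a z → z ≡ a + z - a
    cancel = solve-∀

  eventually-≢0 : ∀ {d} (f : Vec ℤ (suc d)) → last f ≢ 0ℤ →
    ∃[ X ] (∀ x → X ℕ.≤ x → 1 ℕ.≤ value f x)
  eventually-≢0 (a ∷ []) a≢0 = 0 , λ x _ →
    subst (λ v → 1 ℕ.≤ ∣ v ∣) (sym (trans (cong (λ v → a + v) (ℤ.*-zeroʳ (+ x))) (ℤ.+-identityʳ a)))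
      (ℕ.n≢0⇒n>0 (λ eq → a≢0 (ℤ.∣i∣≡0⇒i≡0 eq)))
  eventually-≢0 (a ∷ f@(_ ∷ _)) last≢0 with X , f≢0 ← eventually-≢0 f last≢0 =
    X ℕ.+ suc ∣ a ∣ , λ x x≥ → ℕ.+-cancelʳ-≤ ∣ a ∣ 1 (value (a ∷ f) x)
      (ℕ.≤-trans (ℕ.m+n≤o⇒n≤o X x≥) (x≤∣a+xy∣+∣a∣ a x (eval f (+ x)) (f≢0 x (ℕ.m+n≤o⇒m≤o X x≥))))

  -- The inner polynomial of the Horner form is eventually nonzero, and its multiplication by x then
  -- beats any bound. Nonconstancy supplies this Horner step.
  eventually-> : ∀ {d} (f : Vec ℤ (suc (suc d))) → last f ≢ 0ℤ →
    ∀ B → ∃[ X ] (∀ x → X ℕ.≤ x → B ℕ.< value f x)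
  eventually-> (a ∷ f@(_ ∷ _)) last≢0 B with X , f≢0 ← eventually-≢0 f last≢0 =
    X ℕ.+ (suc B ℕ.+ ∣ a ∣) , λ x x≥ → ℕ.+-cancelʳ-≤ ∣ a ∣ (suc B) (value (a ∷ f) x)
      (ℕ.≤-trans (ℕ.m+n≤o⇒n≤o X x≥) (x≤∣a+xy∣+∣a∣ a x (eval f (+ x)) (f≢0 x (ℕ.m+n≤o⇒m≤o X x≥))))

  module _ {d} (f : Vec ℤ (suc (suc d))) (last≢0 : last f ≢ 0ℤ) (f>0 : PositiveOnℕ f) where

    +value≡eval : ∀ k → + value f (suc k) ≡ eval f (+ suc k)
    +value≡eval k = ℤ.0≤i⇒+∣i∣≡i (ℤ.<⇒≤ (f>0 (+ suc k) (+≤+ (s≤s z≤n))))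

    value≢0 : ∀ k → ℕ.NonZero (value f (suc k))
    value≢0 k = ℤ.>-nonZero (f>0 (+ suc k) (+≤+ (s≤s z≤n)))

    -- Schur's argument: with C = f 1, the value f (1 + C m t) = C (1 + m s) has a
    -- prime factor dividing 1 + m s, which is coprime to m.
    ∃-prime-divisor-of-value : ∀ m .{{_ : NonZero m}} →
      ∃[ p ] ∃[ k ] Prime p × p ℕ.∤ m × p ℕ.∣ value f (suc k)
    ∃-prime-divisor-of-value m
      -- `X` is large enough for the value at 1 + C m X to exceed `C`, which forces the cofactor 1 +
      -- m s to be greater than 1.
      with X , f>C ← eventually-> f last≢0 (value f 1)
      with c , eq ← eval-+ f 1ℤ (+ (value f 1 ℕ.* m ℕ.* X)) = found
      where
      C = value f 1
      instance
        C≢0 : ℕ.NonZero C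
        C≢0 = value≢0 0
      k = C ℕ.* m ℕ.* X
      -- The absolute value changes nothing: C m X c is the difference of the value and `C`, which
      -- is positive.
      s = ∣ + X * c ∣
      C<f : C ℕ.< value f (suc k)
      C<f = f>C (suc k) (ℕ.m≤n⇒m≤1+n (ℕ.m≤n*m X (C ℕ.* m) {{ℕ.m*n≢0 C m}}))
      f≡C+ : + value f (suc k) ≡ + C + + (C ℕ.* m) * (+ X * c)
      f≡C+ = begin
        + value f (suc k)                  ≡⟨ +value≡eval k ⟩
        eval f (+ suc k)                   ≡⟨ eq ⟩
        eval f 1ℤ + + k * c                ≡⟨ cong₂ (λ u v → u + v * c) (sym (+value≡eval 0)) (ℤ.pos-* (C ℕ.* m) X) ⟩
        + C + + (C ℕ.* m) * + X * c        ≡⟨ cong (λ v → + C + v) (ℤ.*-assoc (+ (C ℕ.* m)) (+ X) c) ⟩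
        + C + + (C ℕ.* m) * (+ X * c)      ∎
        where open ≡-Reasoning
      f≡ : value f (suc k) ≡ C ℕ.* suc (m ℕ.* s)
      f≡ = begin
        value f (suc k)                    ≡⟨ ℕ.m+[n∸m]≡n (ℕ.<⇒≤ C<f) ⟨
        C ℕ.+ (value f (suc k) ∸ C)        ≡⟨ cong (C ℕ.+_) diff ⟩
        C ℕ.+ C ℕ.* m ℕ.* s                ≡⟨ cong (C ℕ.+_) (ℕ.*-assoc C m s) ⟩
        C ℕ.+ C ℕ.* (m ℕ.* s)              ≡⟨ ℕ.*-suc C (m ℕ.* s) ⟨
        C ℕ.* suc (m ℕ.* s)                ∎
        where
        open ≡-Reasoning
        cancel : ∀ a z → a + z - a ≡ z
        cancel = solve-∀
        diff : value f (suc k) ∸ C ≡ C ℕ.* m ℕ.* s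
        diff = begin
          value f (suc k) ∸ C                        ≡⟨ cong ∣_∣ (ℤ.⊖-≥ (ℕ.<⇒≤ C<f)) ⟨
          ∣ value f (suc k) ℤ.⊖ C ∣                  ≡⟨ cong ∣_∣ (ℤ.m-n≡m⊖n (value f (suc k)) C) ⟨
          ∣ + value f (suc k) - + C ∣                ≡⟨ cong (λ v → ∣ v - + C ∣) f≡C+ ⟩
          ∣ + C + + (C ℕ.* m) * (+ X * c) - + C ∣    ≡⟨ cong ∣_∣ (cancel (+ C) (+ (C ℕ.* m) * (+ X * c))) ⟩
          ∣ + (C ℕ.* m) * (+ X * c) ∣                ≡⟨ ℤ.abs-* (+ (C ℕ.* m)) (+ X * c) ⟩
          C ℕ.* m ℕ.* s                              ∎
      1<1+ms : 1 ℕ.< suc (m ℕ.* s)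
      1<1+ms = ℕ.*-cancelˡ-< C 1 _ (subst₂ ℕ._<_ (sym (ℕ.*-identityʳ C)) f≡ C<f)
      found : ∃[ p ] ∃[ k ] Prime p × p ℕ.∤ m × p ℕ.∣ value f (suc k)
      found with p , pr , p∣1+ms ← ∃-prime-divisor (suc (m ℕ.* s)) 1<1+ms =
        p , k , pr
        , (λ p∣m → ℕ.>⇒∤ (ℕ.nonTrivial⇒n>1 p {{prime⇒nonTrivial pr}})
            (ℕ.∣m+n∣m⇒∣n (subst (p ℕ.∣_) (ℕ.+-comm 1 (m ℕ.* s)) p∣1+ms) (ℕ.∣m⇒∣m*n s p∣m)))
        , subst (p ℕ.∣_) (sym f≡) (ℕ.∣n⇒∣m*n C p∣1+ms)

  value-periodic : ∀ {n} (f : Vec ℤ n) {p k} → p ℕ.∣ value f k → ∀ j → p ℕ.∣ value f (k ℕ.+ p ℕ.* j)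
  value-periodic f {p} {k} p∣ j with c , eq ← eval-+ f (+ k) (+ (p ℕ.* j)) =
    subst (λ v → p ℕ.∣ ∣ v ∣) (sym eq) (∣⇒∣ᵤ (∣m∣n⇒∣m+n {+ p} {eval f (+ k)} (∣ᵤ⇒∣ p∣)
      (∣m⇒∣m*n {+ p} c (∣ᵤ⇒∣ {+ p} {+ (p ℕ.* j)} (ℕ.m∣m*n j)))))
    where open import Data.Integer.Divisibility.Signed

  valueProduct≡∏ : ∀ {n} (f : Vec ℤ n) → PositiveOnℕ f → ∀ k → valueProduct f k ≡ + ∏ (value f) k
  valueProduct≡∏ f f>0 zero    = refl
  valueProduct≡∏ f f>0 (suc k) = trans
    (cong₂ _*_ (valueProduct≡∏ f f>0 k) (sym (ℤ.0≤i⇒+∣i∣≡i (ℤ.<⇒≤ (f>0 (+ suc k) (+≤+ (s≤s z≤n)))))))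
    (sym (ℤ.pos-* (∏ (value f) k) (value f (suc k))))

  ∏-value-hits : ∀ {d} (f : Vec ℤ (suc (suc d))) → last f ≢ 0ℤ → PositiveOnℕ f → ∀ m → 1 ℕ.< m →
    ∃[ n₀ ] (∀ n → n₀ ℕ.≤ n → ∀ c → Hits m (∏ (value f) n) c)
  ∏-value-hits f last≢0 f>0 m@(suc _) 1<m
    with p , k , pr , p∤m , p∣f ← ∃-prime-divisor-of-value f last≢0 f>0 m =
    ∏-hits (value f) pr (value≢0 f last≢0 f>0) m 1<m p∤m {suc k} (value-periodic f {p} {suc k} p∣f)
      (eval-subexponential f)

-- Limits of rational series and base-m expansions of 1/a.

module RationalExpansions where

  open Arithmetic using (n<2^n)
  open LongDivision using (Division; division?; prefix; digit; power≡)
  open import Data.Nat.Base as ℕ using (ℕ; zero; suc; _^_; _∸_; s≤s; z≤n)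
  import Data.Nat.Properties as ℕ
  open import Data.Nat.Tactic.RingSolver using (solve-∀)
  open import Data.Integer.Base as ℤ using (ℤ; +_)
  import Data.Integer.Properties as ℤ
  open import Data.Rational.Base as ℚ
  import Data.Rational.Properties as ℚ
  open import Data.Rational.Literals using (fromℤ)
  open import Data.Rational.Unnormalised.Base as ℚᵘ using (mkℚᵘ; *≡*; *≤*; *<*)
  import Data.Rational.Unnormalised.Properties as ℚᵘ
  open import Data.Fin.Base as Fin using (Fin; toℕ)
  import Data.Fin.Properties as Fin
  open import Data.Fin.Subset using (Subset; _∈_)
  open import Data.Product.Base
  open import Relation.Nullary
  open import Relation.Nullary.Decidable using (map′)
  open import Relation.Binary.PropositionalEquality

  toℚᵘ-/ : ∀ p q .{{_ : ℕ.NonZero q}} → toℚᵘ (+ p / q) ℚᵘ.≃ (+ p ℚᵘ./ q)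
  toℚᵘ-/ p (suc q) = ℚ.toℚᵘ-fromℚᵘ (mkℚᵘ (+ p) q)

  /-mono-≤ : ∀ {p q r s} .{{_ : ℕ.NonZero q}} .{{_ : ℕ.NonZero s}} →
    p ℕ.* s ℕ.≤ r ℕ.* q → + p / q ≤ + r / s
  /-mono-≤ {p} {q@(suc _)} {r} {s@(suc _)} ps≤rq = ℚ.toℚᵘ-cancel-≤ (begin
    toℚᵘ (+ p / q)   ≃⟨ toℚᵘ-/ p q ⟩
    + p ℚᵘ./ q       ≤⟨ *≤* (subst₂ ℤ._≤_ (ℤ.pos-* p s) (ℤ.pos-* r q) (ℤ.+≤+ ps≤rq)) ⟩
    + r ℚᵘ./ s       ≃⟨ toℚᵘ-/ r s ⟨
    toℚᵘ (+ r / s)   ∎)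
    where open ℚᵘ.≤-Reasoning

  /-mono-< : ∀ {p q r s} .{{_ : ℕ.NonZero q}} .{{_ : ℕ.NonZero s}} →
    p ℕ.* s ℕ.< r ℕ.* q → + p / q < + r / s
  /-mono-< {p} {q@(suc _)} {r} {s@(suc _)} ps<rq = ℚ.toℚᵘ-cancel-< (begin-strict
    toℚᵘ (+ p / q)   ≃⟨ toℚᵘ-/ p q ⟩
    + p ℚᵘ./ q       <⟨ *<* (subst₂ ℤ._<_ (ℤ.pos-* p s) (ℤ.pos-* r q) (ℤ.+<+ ps<rq)) ⟩
    + r ℚᵘ./ s       ≃⟨ toℚᵘ-/ r s ⟨
    toℚᵘ (+ r / s)   ∎)
    where open ℚᵘ.≤-Reasoning

  /-cancel-≤ : ∀ {p q r s} .{{_ : ℕ.NonZero q}} .{{_ : ℕ.NonZero s}} →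
    + p / q ≤ + r / s → p ℕ.* s ℕ.≤ r ℕ.* q
  /-cancel-≤ {p} {q} {r} {s} p/q≤r/s = ℕ.≮⇒≥ λ rq<ps → ℚ.<-irrefl refl (ℚ.<-≤-trans (/-mono-< {r} {s} {p} {q} rq<ps) p/q≤r/s)

  /-+-/ : ∀ {p q r s t u} .{{_ : ℕ.NonZero q}} .{{_ : ℕ.NonZero s}} .{{_ : ℕ.NonZero u}} →
    (p ℕ.* s ℕ.+ r ℕ.* q) ℕ.* u ≡ t ℕ.* (q ℕ.* s) → (+ p / q) + (+ r / s) ≡ + t / u
  /-+-/ {p} {q@(suc _)} {r} {s@(suc _)} {t} {u@(suc _)} eq = ℚ.toℚᵘ-injective (begin-equality
    toℚᵘ ((+ p / q) + (+ r / s))             ≃⟨ ℚ.toℚᵘ-homo-+ (+ p / q) (+ r / s) ⟩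
    toℚᵘ (+ p / q) ℚᵘ.+ toℚᵘ (+ r / s)       ≃⟨ ℚᵘ.+-cong (toℚᵘ-/ p q) (toℚᵘ-/ r s) ⟩
    (+ p ℚᵘ./ q) ℚᵘ.+ (+ r ℚᵘ./ s)           ≃⟨ *≡* (trans (cong (ℤ._* + u) lhs) (trans (sym (ℤ.pos-* (p ℕ.* s ℕ.+ r ℕ.* q) u))
                                                  (trans (cong +_ eq) (ℤ.pos-* t (q ℕ.* s))))) ⟩
    + t ℚᵘ./ u                               ≃⟨ toℚᵘ-/ t u ⟨
    toℚᵘ (+ t / u)                           ∎)
    where
    open ℚᵘ.≤-Reasoning
    lhs : + p ℤ.* + s ℤ.+ + r ℤ.* + q ≡ + (p ℕ.* s ℕ.+ r ℕ.* q)
    lhs = cong₂ ℤ._+_ (sym (ℤ.pos-* p s)) (sym (ℤ.pos-* r q))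

  1/fromℤ≡1/ : ∀ {A a} .{{_ : ℤ.NonZero A}} .{{_ : ℕ.NonZero a}} → A ≡ + a → (1/ fromℤ A) ≡ + 1 / a
  1/fromℤ≡1/ {a = a@(suc _)} refl = ℚ.toℚᵘ-injective (ℚᵘ.≃-sym (toℚᵘ-/ 1 a))

  -- A positive numerator is at least 1. The bound turns a rational ε into an explicit threshold for
  -- convergence.
  1/↧≤ : ∀ p → 0ℚ < p → + 1 / ↧ₙ p ≤ p
  1/↧≤ p@(mkℚ (+ suc n) d _)    _   = ℚ.toℚᵘ-cancel-≤ (begin
    toℚᵘ (+ 1 / suc d)   ≃⟨ toℚᵘ-/ 1 (suc d) ⟩
    mkℚᵘ (+ 1) d         ≤⟨ *≤* (ℤ.*-monoʳ-≤-nonNeg (+ suc d) {+ 1} {+ suc n} (ℤ.+≤+ (s≤s z≤n))) ⟩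
    toℚᵘ p               ∎)
    where open ℚᵘ.≤-Reasoning
  1/↧≤ p@(mkℚ (+ 0) _ _)        0<p with () ← ℚ.positive 0<p
  1/↧≤ p@(mkℚ (ℤ.-[1+ _ ]) _ _) 0<p with () ← ℚ.positive 0<p

  p≤∣p∣ : ∀ p → p ≤ ∣ p ∣
  p≤∣p∣ (mkℚ (+ _) _ _)          = ℚ.≤-refl
  p≤∣p∣ p@(mkℚ (ℤ.-[1+ _ ]) _ _) = ℚ.≤-trans (ℚ.nonPositive⁻¹ p) (ℚ.0≤∣p∣ p)

  ∣p-q∣≡∣q-p∣ : ∀ p q → ∣ p - q ∣ ≡ ∣ q - p ∣
  ∣p-q∣≡∣q-p∣ p q = trans (sym (ℚ.∣-p∣≡∣p∣ (p - q))) (cong ∣_∣ (⁻¹-anti-homo-// p q))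
    where open import Algebra.Properties.Group ℚ.+-0-group

  p<q⇒0<q-p : ∀ {p q} → p < q → 0ℚ < q - p
  p<q⇒0<q-p {p} {q} p<q = subst (_< q - p) (ℚ.+-inverseʳ p) (ℚ.+-monoˡ-< (- p) p<q)

  module _ {u : ℕ → ℚ} {x : ℚ} (∑u≡x : HasSum u x) where

    limit-≥ : ∀ {q} N → (∀ j → q ≤ partialSum u (j ℕ.+ N)) → q ≤ x
    limit-≥ {q} N q≤S = ℚ.≮⇒≥ λ x<q →
      let N₀ , close = ∑u≡x (q - x) (p<q⇒0<q-p x<q)
          S = partialSum u (N₀ ℕ.+ N)
      in ℚ.<-irrefl refl (begin-strict
        q - x       ≤⟨ ℚ.+-monoˡ-≤ (- x) (q≤S N₀) ⟩
        S - x       ≤⟨ p≤∣p∣ (S - x) ⟩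
        ∣ S - x ∣   <⟨ close (N₀ ℕ.+ N) (ℕ.m≤m+n N₀ N) ⟩
        q - x       ∎)
      where open ℚ.≤-Reasoning

    limit-≤ : ∀ {q} N → (∀ j → partialSum u (j ℕ.+ N) ≤ q) → x ≤ q
    limit-≤ {q} N S≤q = ℚ.≮⇒≥ λ q<x →
      let N₀ , close = ∑u≡x (x - q) (p<q⇒0<q-p q<x)
          S = partialSum u (N₀ ℕ.+ N)
      in ℚ.<-irrefl refl (begin-strict
        x - q       ≤⟨ ℚ.+-monoʳ-≤ x (ℚ.neg-antimono-≤ (S≤q N₀)) ⟩
        x - S       ≤⟨ p≤∣p∣ (x - S) ⟩
        ∣ x - S ∣   ≡⟨ ∣p-q∣≡∣q-p∣ x S ⟩
        ∣ S - x ∣   <⟨ close (N₀ ℕ.+ N) (ℕ.m≤m+n N₀ N) ⟩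
        x - q       ∎)
      where open ℚ.≤-Reasoning

  module _ {m : ℕ} .{{_ : ℕ.NonZero m}} (b : ℕ → Fin m) where

    private
      m^≢0 : ∀ n → ℕ.NonZero (m ^ n)
      m^≢0 n = ℕ.m^n≢0 m n

      _/m^_ : ℕ → ℕ → ℚ
      p /m^ N = (+ p / m ^ N) {{m^≢0 N}}

    partialSum≡prefix/ : ∀ N → partialSum (digitTerm b) N ≡ prefix b N /m^ N
    partialSum≡prefix/ zero    = refl
    partialSum≡prefix/ (suc N) = trans (cong (λ v → v + digitTerm b (suc N)) (partialSum≡prefix/ N))
      (/-+-/ {prefix b N} {m ^ N} {toℕ (b (suc N))} {m ^ suc N} {prefix b (suc N)} {m ^ suc N} {{m^≢0 N}} {{m^≢0 (suc N)}} {{m^≢0 (suc N)}}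
        (comm (prefix b N) m (m ^ N) (toℕ (b (suc N)))))
      where
      comm : ∀ P m M d → (P ℕ.* (m ℕ.* M) ℕ.+ d ℕ.* M) ℕ.* (m ℕ.* M) ≡ (m ℕ.* P ℕ.+ d) ℕ.* (M ℕ.* (m ℕ.* M))
      comm = solve-∀

    -- Cross-multiplied form of the fact that the left ends P / m^N of the nested m-adic intervals
    -- never decrease.
    prefix-≥ : ∀ N j → prefix b N ℕ.* m ^ (j ℕ.+ N) ℕ.≤ prefix b (j ℕ.+ N) ℕ.* m ^ N
    prefix-≥ N zero    = ℕ.≤-refl
    prefix-≥ N (suc j) = begin
      prefix b N ℕ.* (m ℕ.* m ^ (j ℕ.+ N))       ≡⟨ comm (prefix b N) m (m ^ (j ℕ.+ N)) ⟩
      m ℕ.* (prefix b N ℕ.* m ^ (j ℕ.+ N))       ≤⟨ ℕ.*-monoʳ-≤ m (prefix-≥ N j) ⟩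
      m ℕ.* (prefix b (j ℕ.+ N) ℕ.* m ^ N)       ≡⟨ ℕ.*-assoc m (prefix b (j ℕ.+ N)) (m ^ N) ⟨
      m ℕ.* prefix b (j ℕ.+ N) ℕ.* m ^ N         ≤⟨ ℕ.*-monoˡ-≤ (m ^ N) (ℕ.m≤m+n (m ℕ.* prefix b (j ℕ.+ N)) _) ⟩
      prefix b (suc j ℕ.+ N) ℕ.* m ^ N           ∎
      where
      open ℕ.≤-Reasoning
      comm : ∀ a b c → a ℕ.* (b ℕ.* c) ≡ b ℕ.* (a ℕ.* c)
      comm = solve-∀

    -- The right ends (P + 1) / m^N never increase, because a digit is at most m - 1 and so m P + b
    -- + 1 ≤ m (P + 1).
    prefix-< : ∀ N j → suc (prefix b (j ℕ.+ N)) ℕ.* m ^ N ℕ.≤ suc (prefix b N) ℕ.* m ^ (j ℕ.+ N)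
    prefix-< N zero    = ℕ.≤-refl
    prefix-< N (suc j) = begin
      suc (m ℕ.* P ℕ.+ toℕ (b (suc (j ℕ.+ N)))) ℕ.* m ^ N   ≤⟨ ℕ.*-monoˡ-≤ (m ^ N) 1+mP+b≤ ⟩
      m ℕ.* suc P ℕ.* m ^ N                                 ≡⟨ ℕ.*-assoc m (suc P) (m ^ N) ⟩
      m ℕ.* (suc P ℕ.* m ^ N)                               ≤⟨ ℕ.*-monoʳ-≤ m (prefix-< N j) ⟩
      m ℕ.* (suc (prefix b N) ℕ.* m ^ (j ℕ.+ N))              ≡⟨ comm m (suc (prefix b N)) (m ^ (j ℕ.+ N)) ⟩
      suc (prefix b N) ℕ.* m ^ (suc j ℕ.+ N)                  ∎
      where
      open ℕ.≤-Reasoning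
      P = prefix b (j ℕ.+ N)
      comm : ∀ a b c → a ℕ.* (b ℕ.* c) ≡ b ℕ.* (a ℕ.* c)
      comm = solve-∀
      1+mP+b≤ : suc (m ℕ.* P ℕ.+ toℕ (b (suc (j ℕ.+ N)))) ℕ.≤ m ℕ.* suc P
      1+mP+b≤ = begin
        suc (m ℕ.* P ℕ.+ toℕ (b (suc (j ℕ.+ N))))   ≡⟨ ℕ.+-suc (m ℕ.* P) _ ⟨
        m ℕ.* P ℕ.+ suc (toℕ (b (suc (j ℕ.+ N))))   ≤⟨ ℕ.+-monoʳ-≤ (m ℕ.* P) (Fin.toℕ<n (b (suc (j ℕ.+ N)))) ⟩
        m ℕ.* P ℕ.+ m                               ≡⟨ trans (ℕ.+-comm (m ℕ.* P) m) (sym (ℕ.*-suc m P)) ⟩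
        m ℕ.* suc P                                 ∎

    -- The N-th m-adic interval contains all later partial sums and, being closed, also their limit.
    -- Equality on the right occurs for expansions that continue with m - 1 forever.
    prefix-bounds : ∀ {a} .{{_ : ℕ.NonZero a}} → HasSum (digitTerm b) (+ 1 / a) →
      ∀ N → a ℕ.* prefix b N ℕ.≤ m ^ N × m ^ N ℕ.≤ a ℕ.* prefix b N ℕ.+ a
    prefix-bounds {a} {{a≢0}} ∑≡ N
      = subst₂ ℕ._≤_ (ℕ.*-comm (prefix b N) a) (ℕ.*-identityˡ (m ^ N)) (/-cancel-≤ {prefix b N} {m ^ N} {1} {a} {{m^≢0 N}}
          (limit-≥ ∑≡ N λ j → subst (prefix b N /m^ N ≤_) (sym (partialSum≡prefix/ (j ℕ.+ N)))
            (/-mono-≤ {prefix b N} {m ^ N} {prefix b (j ℕ.+ N)} {m ^ (j ℕ.+ N)} {{m^≢0 N}} {{m^≢0 (j ℕ.+ N)}} (prefix-≥ N j))))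
      , subst₂ ℕ._≤_ (ℕ.*-identityˡ (m ^ N)) (trans (ℕ.*-comm (suc (prefix b N)) a) (trans (ℕ.*-suc a (prefix b N)) (ℕ.+-comm a _)))
          (/-cancel-≤ {1} {a} {suc (prefix b N)} {m ^ N} {{a≢0}} {{m^≢0 N}}
            (limit-≤ ∑≡ N λ j → subst (_≤ suc (prefix b N) /m^ N) (sym (partialSum≡prefix/ (j ℕ.+ N)))
              (/-mono-≤ {prefix b (j ℕ.+ N)} {m ^ (j ℕ.+ N)} {suc (prefix b N)} {m ^ N} {{m^≢0 (j ℕ.+ N)}} {{m^≢0 N}}
                (ℕ.≤-trans (ℕ.*-monoˡ-≤ (m ^ N) (ℕ.n≤1+n (prefix b (j ℕ.+ N)))) (prefix-< N j)))))

    prefix-converges : ∀ {a} .{{_ : ℕ.NonZero a}} → 1 ℕ.< m →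
      (∀ N → a ℕ.* prefix b N ℕ.≤ m ^ N × m ^ N ℕ.≤ a ℕ.* prefix b N ℕ.+ a) →
      HasSum (digitTerm b) (+ 1 / a)
    prefix-converges {a} {{a≢0}} 1<m bounds ε 0<ε = d , close
      where
      open ℚ.≤-Reasoning
      -- The denominator of ε serves as threshold: for N ≥ d one has m^N ≥ 2^N > d, and ε ≥ 1/d.
      d = ↧ₙ ε
      x = + 1 / a
      close : ∀ N → d ℕ.≤ N → ∣ partialSum (digitTerm b) N - x ∣ < ε
      close N d≤N = begin-strict
        ∣ partialSum (digitTerm b) N - x ∣   ≡⟨ cong (λ v → ∣ v - x ∣) (partialSum≡prefix/ N) ⟩
        ∣ S - x ∣                            ≡⟨ ∣p-q∣≡∣q-p∣ S x ⟩
        ∣ x - S ∣                            ≡⟨ ℚ.0≤p⇒∣p∣≡p 0≤x-S ⟩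
        x - S                                ≤⟨ x-S≤ ⟩
        1 /m^ N                          <⟨ /-mono-< {1} {m ^ N} {1} {d} {{m^≢0 N}} (subst₂ ℕ._<_ (sym (ℕ.*-identityˡ d)) (sym (ℕ.*-identityˡ (m ^ N))) d<m^N) ⟩
        + 1 / d                              ≤⟨ 1/↧≤ ε 0<ε ⟩
        ε                                    ∎
        where
        S = prefix b N /m^ N
        d<m^N : d ℕ.< m ^ N
        d<m^N = ℕ.≤-<-trans d≤N (ℕ.<-≤-trans (n<2^n N) (ℕ.^-monoˡ-≤ N 1<m))
        0≤x-S : 0ℚ ≤ x - S
        0≤x-S = subst (_≤ x - S) (ℚ.+-inverseʳ S) (ℚ.+-monoˡ-≤ (- S) (/-mono-≤ {prefix b N} {m ^ N} {1} {a} {{m^≢0 N}}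
          (subst₂ ℕ._≤_ (ℕ.*-comm a (prefix b N)) (sym (ℕ.*-identityˡ (m ^ N))) (proj₁ (bounds N)))))
        x≤1/m^N+S : x ≤ (1 /m^ N) + S
        x≤1/m^N+S = subst (x ≤_) (sym (/-+-/ {1} {m ^ N} {prefix b N} {m ^ N} {suc (prefix b N)} {m ^ N} {{m^≢0 N}} {{m^≢0 N}} {{m^≢0 N}} (regroup (m ^ N) (prefix b N))))
          (/-mono-≤ {1} {a} {suc (prefix b N)} {m ^ N} {{a≢0}} {{m^≢0 N}}
            (subst₂ ℕ._≤_ (sym (ℕ.*-identityˡ (m ^ N))) (trans (ℕ.+-comm _ a) (trans (sym (ℕ.*-suc a (prefix b N))) (ℕ.*-comm a (suc (prefix b N))))) (proj₂ (bounds N))))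
          where
          regroup : ∀ M P → (1 ℕ.* M ℕ.+ P ℕ.* M) ℕ.* M ≡ suc P ℕ.* (M ℕ.* M)
          regroup = solve-∀
        x-S≤ : x - S ≤ 1 /m^ N
        x-S≤ = subst (x - S ≤_) (trans (ℚ.+-assoc (1 /m^ N) S (- S)) (trans (cong (λ v → (1 /m^ N) + v) (ℚ.+-inverseʳ S)) (ℚ.+-identityʳ (1 /m^ N))))
          (ℚ.+-monoˡ-≤ (- S) x≤1/m^N+S)

  module _ {m : ℕ} (1<m : 1 ℕ.< m) (D : Subset m) {a : ℕ} .{{_ : ℕ.NonZero a}} where

    private instance
      m≢0 : ℕ.NonZero m
      m≢0 = ℕ.>-nonZero (ℕ.<-trans (s≤s z≤n) 1<m)

    K⇒division : K m D (+ 1 / a) → Division m D a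
    K⇒division (b , b∈D , ∑≡) = ρ , trans (cong (1 ∸_) (ℕ.*-zeroʳ a)) refl
      , (λ j → ℕ.m≤n+o⇒m∸n≤o (m ^ j) (a ℕ.* prefix b j) (proj₂ (bounds j)))
      , λ j → b (suc j) , b∈D (suc j) (s≤s z≤n) , step j
      where
      open ≡-Reasoning
      bounds = prefix-bounds b ∑≡
      ρ : ℕ → ℕ
      -- The lower bound on m^j makes this truncated subtraction exact; the upper bound gives ρ j ≤
      -- a.
      ρ j = m ^ j ∸ a ℕ.* prefix b j
      aP+ρ≡ : ∀ j → a ℕ.* prefix b j ℕ.+ ρ j ≡ m ^ j
      aP+ρ≡ j = ℕ.m+[n∸m]≡n (proj₁ (bounds j))
      step : ∀ j → m ℕ.* ρ j ≡ a ℕ.* toℕ (b (suc j)) ℕ.+ ρ (suc j)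
      step j = ℕ.+-cancelˡ-≡ (m ℕ.* (a ℕ.* prefix b j)) _ _ (begin
        m ℕ.* (a ℕ.* prefix b j) ℕ.+ m ℕ.* ρ j                            ≡⟨ ℕ.*-distribˡ-+ m _ (ρ j) ⟨
        m ℕ.* (a ℕ.* prefix b j ℕ.+ ρ j)                                  ≡⟨ cong (m ℕ.*_) (aP+ρ≡ j) ⟩
        m ^ suc j                                                         ≡⟨ aP+ρ≡ (suc j) ⟨
        a ℕ.* (m ℕ.* prefix b j ℕ.+ toℕ (b (suc j))) ℕ.+ ρ (suc j)        ≡⟨ regroup m a (prefix b j) (toℕ (b (suc j))) (ρ (suc j)) ⟩
        m ℕ.* (a ℕ.* prefix b j) ℕ.+ (a ℕ.* toℕ (b (suc j)) ℕ.+ ρ (suc j)) ∎)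
        where
        regroup : ∀ m a P b ρ → a ℕ.* (m ℕ.* P ℕ.+ b) ℕ.+ ρ ≡ m ℕ.* (a ℕ.* P) ℕ.+ (a ℕ.* b ℕ.+ ρ)
        regroup = solve-∀

    division⇒K : Division m D a → K m D (+ 1 / a)
    division⇒K (ρ , ρ₀≡1 , ρ≤a , path) =
      b , (λ j _ → proj₁ (proj₂ (path (ℕ.pred j)))) , prefix-converges b 1<m bounds
      where
      b = digit m D a ρ₀≡1 ρ≤a path
      m^≡ = power≡ m D a ρ₀≡1 ρ≤a path
      bounds : ∀ N → a ℕ.* prefix b N ℕ.≤ m ^ N × m ^ N ℕ.≤ a ℕ.* prefix b N ℕ.+ a
      bounds N = subst (a ℕ.* prefix b N ℕ.≤_) (sym (m^≡ N)) (ℕ.m≤m+n _ (ρ N))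
               , subst (ℕ._≤ a ℕ.* prefix b N ℕ.+ a) (sym (m^≡ N)) (ℕ.+-monoʳ-≤ (a ℕ.* prefix b N) (ρ≤a N))

    K? : Dec (K m D (+ 1 / a))
    K? = map′ division⇒K K⇒division (division? m D a)

-- Finiteness of the intersection.

open Arithmetic using (∏; ∏-nonZero)
open LongDivision using (∃∉; hits⇒∈D)
open PolynomialValues using (value; value≢0; valueProduct≡∏; ∏-value-hits)
open RationalExpansions using (1/fromℤ≡1/; K⇒division; K?)

open import Data.Nat.Base using (ℕ; suc; _≤_; _<_)
open import Data.Integer.Base using (ℤ; 0ℤ)
open import Data.Fin.Subset using (Subset; ∣_∣)
open import Data.Vec.Base using (Vec; last)
open import Relation.Binary.PropositionalEquality.Core using (_≢_)
open import Relation.Unary using (_∩_)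

import Data.Nat.Base as ℕ
import Data.Nat.Properties as ℕ
open import Data.Fin.Base using (toℕ)
open import Data.Integer.Base using (+_)
open import Data.List.Base using (List; applyUpTo; filter; map)
open import Data.List.Membership.Propositional using (_∈_)
open import Data.List.Membership.Propositional.Properties
  using (∈-map⁺; ∈-map⁻; ∈-filter⁺; ∈-filter⁻; ∈-applyUpTo⁺; ∈-applyUpTo⁻)
open import Data.Product.Base using (_×_; _,_; ∃-syntax)
open import Data.Rational.Base using (ℚ; 1/_; _/_)
open import Data.Rational.Literals using (fromℤ)
open import Relation.Nullary using (¬_; Dec; yes; no; contradiction)
open import Relation.Unary using (Pred)
open import Level using (0ℓ)
open import Relation.Binary.PropositionalEquality using (_≡_; refl; sym; subst)

-- Only the indices 1, ..., n₀ need testing, and `P?` selects exactly those whose value satisfies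
-- `P`. Repeated values in the list are harmless.
finite-∩ : ∀ (r : ℕ → ℚ) {P : Pred ℚ 0ℓ} → (∀ n → Dec (P (r n))) →
  ∀ n₀ → (∀ n → n₀ ≤ n → ¬ P (r n)) →
  Finite ((λ x → ∃[ n ] 1 ≤ n × x ≡ r n) ∩ P)
finite-∩ r {P} P? n₀ ¬P = elements , complete , sound
  where
  elements : List ℚ
  elements = map r (filter (λ n → P? n) (applyUpTo suc n₀))

  complete : ∀ {x} → (∃[ n ] 1 ≤ n × x ≡ r n) × P x → x ∈ elements
  complete ((suc n , _ , refl) , p) with n ℕ.<? n₀
  ... | yes n<n₀ = ∈-map⁺ r (∈-filter⁺ P? (∈-applyUpTo⁺ suc n<n₀) p)
  ... | no  n≮n₀ = contradiction p (¬P (suc n) (ℕ.m≤n⇒m≤1+n (ℕ.≮⇒≥ n≮n₀)))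

  sound : ∀ {x} → x ∈ elements → (∃[ n ] 1 ≤ n × x ≡ r n) × P x
  sound x∈
    with n , n∈ , refl ← ∈-map⁻ r x∈
    with n∈indices , p ← ∈-filter⁻ P? {xs = applyUpTo suc n₀} n∈
    with i , _ , refl ← ∈-applyUpTo⁻ suc n∈indices =
    (suc i , ℕ.s≤s ℕ.z≤n , refl) , p

proposition4p7 : (m : ℕ) → 3 ≤ m →
    (D : Subset m) → 1 < ∣ D ∣ → ∣ D ∣ < m →
    (d : ℕ) → 1 ≤ d →
    (f : Vec ℤ (suc d)) → last f ≢ 0ℤ →
    (f>0 : PositiveOnℕ f) →
    Finite (Reciprocals f f>0 ∩ K m D)
proposition4p7 m 3≤m D _ ∣D∣<m (suc _) _ f last≢0 f>0 =
  -- From n₀ on, membership of 1/aₙ in K would give a division with digits in `D` that is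
  -- nevertheless forced to emit the missing digit `c`.
  let c , c∉D   = ∃∉ D ∣D∣<m
      n₀ , hits = ∏-value-hits f last≢0 f>0 m 1<m
  in finite-∩ reciprocal reciprocal∈K? n₀ λ n n₀≤n ∈K →
       let ρ , ρ₀≡1 , ρ≤a , path = K⇒division 1<m D {{a≢0 n}} (subst (K m D) (reciprocal≡ n) ∈K)
       in c∉D (hits⇒∈D m D (a n) ρ₀≡1 ρ≤a path c (hits n n₀≤n (toℕ c)))
  where
  1<m : 1 < m
  1<m = ℕ.<⇒≤ 3≤m

  a : ℕ → ℕ
  a = ∏ (value f)

  a≢0 : ∀ n → ℕ.NonZero (a n)
  a≢0 = ∏-nonZero (value f) (value≢0 f last≢0 f>0)

  reciprocal : ℕ → ℚ
  reciprocal n = (1/ fromℤ (valueProduct f n)) {{valueProduct≢0 f f>0 n}}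

  reciprocal≡ : ∀ n → reciprocal n ≡ (+ 1 / a n) {{a≢0 n}}
  reciprocal≡ n = 1/fromℤ≡1/ {{valueProduct≢0 f f>0 n}} {{a≢0 n}} (valueProduct≡∏ f f>0 n)

  reciprocal∈K? : ∀ n → Dec (K m D (reciprocal n))
  reciprocal∈K? n = subst (λ x → Dec (K m D x)) (sym (reciprocal≡ n)) (K? 1<m D {{a≢0 n}})
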